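{- Let $k > 1$ be an integer, let $n \geq 1$ be an integer, and let $G$ be a simple graph on $n$ vertices. Let $c : E(G) \to \{1, \dots, n\}$ be a function such that $|c^{ -1}(i)| \geq 301\, k \log k$ for all $i \in \{1, \dots, n\}$. Then $G$ contains a rainbow cycle (with respect to $c$) of length at most $\lceil n/k \rceil$.
   Context: Graphs are finite. A graph is simple if it has no loops or parallel edges. $\log$ denotes the logarithm with base $2$. The function $c$ is called a coloring of the edges of $G$; it is not required to be a proper edge-coloring (edges sharing an end may receive the same color). A rainbow cycle with respect to $c$ is a cycle $C$ in $G$ such that $c(e) \neq c(f)$ for all $e, f \in E(C)$ with $e \neq f$. The length of a cycle is its number of edges. -}

module Defs where

open import Data.Fin using (Fin; zero; suc; inject₁; fromℕ; _≟_)
open import Data.Integer using (+_; -[1+_])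
open import Data.List using (length; filter; allFin)
open import Data.Nat using (ℕ; suc; _*_; _^_; _<_; NonZero)
open import Data.Product using (_×_; _,_; ∃-syntax)
open import Data.Rational.Unnormalised as ℚᵘ using (ℚᵘ; mkℚᵘ; _/_)
open import Data.Sum using (_⊎_)
open import Function.Definitions using (Injective)
open import Level using (0ℓ)
open import Relation.Binary.PropositionalEquality using (_≡_; _≢_)
open import Relation.Nullary using (¬_)
open import Relation.Unary using (Pred; _⊆_)

-- A real number x is represented by its lower Dedekind cut, the set of
-- rationals strictly below x; the order is inclusion of cuts.
Cut : Set₁
Cut = Pred ℚᵘ 0ℓ

infix 4 _≤ᶜ_
_≤ᶜ_ : Cut → Cut → Set
x ≤ᶜ y = x ⊆ y

fromNat : ℕ → Cut
fromNat m r = r ℚᵘ.< (+ m / 1)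

-- r < a · x  iff  r / a < x, as a > 0.
infixr 7 _∙_
_∙_ : (a : ℕ) .{{_ : NonZero a}} → Cut → Cut
(a ∙ x) r = x (r ℚᵘ.* (+ 1 / a))

-- p / q < log₂ k  iff  2 ^ (p / q) < k  iff  2 ^ p < k ^ q  (q = suc d > 0);
-- for a negative numerator, 2 ^ p is moved to the other side.
log₂ : (k : ℕ) .{{_ : NonZero k}} → Cut
log₂ k (mkℚᵘ (+ p)    d) = 2 ^ p < k ^ suc d
log₂ k (mkℚᵘ -[1+ p ] d) = 1 < k ^ suc d * 2 ^ suc p

-- A finite graph with vertex set Fin n and edge set Fin size; the order in
-- which `ends` lists the two ends of an edge carries no meaning.
record Graph (n : ℕ) : Set where
  field
    size : ℕ
    ends : Fin size → Fin n × Fin n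

  Edge : Set
  Edge = Fin size

  Joins : Edge → Fin n → Fin n → Set
  Joins e u v = (ends e ≡ (u , v)) ⊎ (ends e ≡ (v , u))

  Simple : Set
  Simple = (∀ e u → ¬ Joins e u u)
         × (∀ e f u v → Joins e u v → Joins f u v → e ≡ f)

-- Distinct vertices v₀, …, vₗ and distinct edges e₀, …, eₗ, with eⱼ joining
-- vⱼ and vⱼ₊₁ for j < l, and eₗ joining vₗ and v₀.  In a graph with loops or
-- parallel edges these include cycles of length 1 and 2; in a simple graph
-- the length is necessarily at least 3.
record Cycle {n : ℕ} (G : Graph n) : Set where
  open Graph G
  field
    l           : ℕ
    vertex      : Fin (suc l) → Fin n
    edge        : Fin (suc l) → Edge
    vertex-inj  : Injective _≡_ _≡_ vertex
    edge-inj    : Injective _≡_ _≡_ edge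
    step        : ∀ (j : Fin l) →
                  Joins (edge (inject₁ j)) (vertex (inject₁ j)) (vertex (suc j))
    close       : Joins (edge (fromℕ l)) (vertex (fromℕ l)) (vertex zero)

  cycleLength : ℕ
  cycleLength = suc l

  _∈E : Edge → Set
  e ∈E = ∃[ j ] edge j ≡ e

module _ {n : ℕ} {G : Graph n} where
  open Graph G
  open Cycle

  Rainbow : {a : ℕ} → (Edge → Fin a) → Cycle G → Set
  Rainbow c C = ∀ e f → _∈E C e → _∈E C f → e ≢ f → c e ≢ c f

-- |c⁻¹(i)|
classSize : {m a : ℕ} → (Fin m → Fin a) → Fin a → ℕ
classSize {m} c i = length (filter (λ e → c e ≟ i) (allFin m))

{-# OPTIONS --safe #-}
-- Write κ = k ⌊log₂ k⌋.  A colour is a star if all its edges share a vertex, its centre.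
-- Let Z be the set of vertices that are not centres; there are at most |Z| colours that
-- are not stars.
--
-- If Z is large, some 16κ vertices of Z can be deleted without destroying a colour: a star
-- has its centre outside Z and more than 16κ leaves, and a set that covers another colour
-- contains one of four pairs, so that it is enough to find an independent set in a graph
-- with |Z| vertices and at most 4|Z| edges.  One edge of each remaining colour then gives
-- n edges on n − 16κ vertices, and growing balls in this rainbow graph shows that its girth
-- is at most 2R + 2, where R is about (n / 16κ) log₂ (16κ).
--
-- If Z is small, every centre is joined, in the colour of which it is the centre, to many
-- other centres, and greedily some set Y of at most n / k centres meets all these
-- neighbourhoods.  Following edges from Y to Y closes a cycle, which is rainbow because
-- each of its vertices is left in its own colour.
module Submission where

open import Defs
open import Data.Fin using (Fin; zero; suc; inject₁; fromℕ; toℕ; _≟_)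
open import Data.Fin.Properties using (any?; pigeonhole; toℕ-injective; toℕ<n; toℕ-inject₁; toℕ-fromℕ)
open import Data.Integer using (+_) renaming (_≤_ to _≤ᶻ_)
import Data.Integer as ℤ
import Data.Integer.DivMod as ℤ
import Data.Integer.Properties as ℤ
open import Data.List using (List; []; _∷_; _++_; length; filter; map; allFin; take; lookup; cartesianProduct)
open import Data.List.Membership.Propositional using (_∈_; _∉_; find; lose)
open import Data.List.Membership.Propositional.Properties
open import Data.List.Properties using (length-++; length-map; length-take; length-tabulate)
open import Data.List.Relation.Unary.All as All using (All; []; _∷_)
open import Data.List.Relation.Unary.All.Properties using (All¬⇒¬Any; ¬Any⇒All¬; ¬All⇒Any¬)
open import Data.List.Relation.Unary.AllPairs using ([]; _∷_)
open import Data.List.Relation.Unary.Any as Any using (here; there)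
open import Data.List.Relation.Unary.Any.Properties using (lookup-index)
open import Data.List.Relation.Unary.Unique.Propositional using (Unique)
import Data.List.Relation.Unary.Unique.Propositional.Properties as Uniq
open import Data.Nat hiding (_≟_; _/_)
import Data.Nat as ℕ
open import Data.Nat.DivMod using (m≡m%n+[m/n]*n; m%n<n; m/n*n≤m; m*n/n≡m; /-monoˡ-≤)
open import Data.Nat.GeneralisedArithmetic using (fold; fold-+)
open import Data.Nat.ListAction using (sum)
open import Data.Nat.Properties hiding (_≟_)
open import Data.Nat.Tactic.RingSolver using (solve-∀)
open import Data.Product using (∃; ∃-syntax; Σ-syntax; _×_; _,_; proj₁; proj₂)
open import Data.Product.Properties using (≡-dec)
open import Data.Rational.Unnormalised using (mkℚᵘ; _/_; ceiling)
import Data.Rational.Unnormalised.Properties as ℚᵘ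
open import Data.Sum using (_⊎_; inj₁; inj₂; [_,_]′; swap)
open import Data.Unit using (⊤; tt)
open import Function using (_∘_; id)
open import Function.Definitions using (Injective)
open import Level using (0ℓ)
open import Relation.Binary using (DecidableEquality; tri<; tri≈; tri>)
open import Relation.Binary.PropositionalEquality
open import Relation.Nullary using (¬_; Dec; yes; no; contradiction; _×-dec_; _⊎-dec_)
open import Relation.Unary using (Pred; Decidable)
open import Relation.Unary.Properties using (∁?)

-- Lists

private
  variable
    A B : Set
    P : Pred A 0ℓ

+-left-comm : ∀ a b c → a + (b + c) ≡ b + (a + c)
+-left-comm = solve-∀

∈-remove : ∀ {x y : A} {ys} → (x∈ : x ∈ ys) → y ∈ ys → y ≢ x → y ∈ (ys Any.─ x∈)
∈-remove (here refl) (here refl) y≢x = contradiction refl y≢x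
∈-remove (here refl) (there y∈)  y≢x = y∈
∈-remove (there x∈)  (here refl) y≢x = here refl
∈-remove (there x∈)  (there y∈)  y≢x = there (∈-remove x∈ y∈ y≢x)

length-remove : ∀ {x : A} {ys} → (x∈ : x ∈ ys) → length ys ≡ suc (length (ys Any.─ x∈))
length-remove (here refl) = refl
length-remove (there x∈)  = cong suc (length-remove x∈)

unique-⊆⇒length-≤ : ∀ {xs ys : List A} → Unique xs → (∀ {x} → x ∈ xs → x ∈ ys) →
                    length xs ≤ length ys
unique-⊆⇒length-≤ {xs = []}     _        _  = z≤n
unique-⊆⇒length-≤ {xs = x ∷ xs} {ys} (x∉ ∷ u) xs⊆ = begin
  suc (length xs)           ≤⟨ s≤s (unique-⊆⇒length-≤ u λ {y} y∈ →
                                 ∈-remove x∈ (xs⊆ (there y∈)) λ { refl → All¬⇒¬Any x∉ y∈ }) ⟩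
  suc (length (ys Any.─ x∈)) ≡⟨ length-remove x∈ ⟨
  length ys                 ∎
  where
  open ≤-Reasoning
  x∈ = xs⊆ (here refl)

length-filter-∁ : (P? : Decidable P) (xs : List A) →
                  length (filter P? xs) + length (filter (∁? P?) xs) ≡ length xs
length-filter-∁ P? []       = refl
length-filter-∁ P? (x ∷ xs) with P? x
... | yes _ = cong suc (length-filter-∁ P? xs)
... | no  _ = trans (+-suc _ _) (cong suc (length-filter-∁ P? xs))

length-allFin : ∀ n → length (allFin n) ≡ n
length-allFin n = length-tabulate {n = n} id

module _ (_≟A_ : DecidableEquality A) where
  open import Data.List.Membership.DecPropositional _≟A_ using (_∈?_; _∉?_)

  unique-⊆⇒length-filter-∉ : ∀ {xs ys : List A} → Unique ys → (∀ {y} → y ∈ ys → y ∈ xs) →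
                             length ys + length (filter (_∉? ys) xs) ≤ length xs
  unique-⊆⇒length-filter-∉ {xs} {ys} u ys⊆ = begin
    length ys + length (filter (_∉? ys) xs)
      ≤⟨ +-monoˡ-≤ _ (unique-⊆⇒length-≤ u λ y∈ → ∈-filter⁺ (_∈? ys) (ys⊆ y∈) y∈) ⟩
    length (filter (_∈? ys) xs) + length (filter (_∉? ys) xs)
      ≡⟨ length-filter-∁ (_∈? ys) xs ⟩
    length xs ∎
    where open ≤-Reasoning

  -- The collision is returned as data because each use needs the two elements: they become the two
  -- edges that close a cycle, or two edges that contradict simplicity.
  unique-map⊎collision : (f : B → A) {xs : List B} → Unique xs →
    Unique (map f xs) ⊎ (∃[ x ] ∃[ y ] x ∈ xs × y ∈ xs × x ≢ y × f x ≡ f y)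
  unique-map⊎collision f [] = inj₁ []
  unique-map⊎collision f {x ∷ xs} (x∉ ∷ u) with unique-map⊎collision f u
  ... | inj₂ (a , b , a∈ , b∈ , rest) = inj₂ (a , b , there a∈ , there b∈ , rest)
  ... | inj₁ u′ with f x ∈? map f xs
  ...   | no fx∉ = inj₁ (¬Any⇒All¬ _ fx∉ ∷ u′)
  ...   | yes fx∈ with ∈-map⁻ f fx∈
  ...     | y , y∈ , eq = inj₂ (x , y , here refl , there y∈ , All.lookup x∉ y∈ , eq)

length-cartesianProduct : (xs : List A) (ys : List B) →
                          length (cartesianProduct xs ys) ≡ length xs * length ys
length-cartesianProduct []       ys = refl
length-cartesianProduct (x ∷ xs) ys =
  trans (length-++ (map (x ,_) ys))
        (cong₂ _+_ (length-map (x ,_) ys) (length-cartesianProduct xs ys))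

take-⊆ : ∀ m {x : A} xs → x ∈ take m xs → x ∈ xs
take-⊆ (suc m) (y ∷ xs) (here px)  = here px
take-⊆ (suc m) (y ∷ xs) (there x∈) = there (take-⊆ m xs x∈)

-- Independent sets by deletion: a vertex in at least 8 pairs is discarded, any other
-- vertex is kept at the price of itself and at most 7 neighbours.
module _ (_≟A_ : DecidableEquality A) where
  open import Data.List.Membership.DecPropositional _≟A_ using (_∈?_; _∉?_)

  -- The conclusion is `a ≡ b` and not absurdity, so a pair of equal entries forbids nothing.
  Independent : List (A × A) → List A → Set
  Independent ps xs = ∀ {a b} → (a , b) ∈ ps → a ∈ xs → b ∈ xs → a ≡ b

  private
    Meets : A → A × A → Set
    Meets v (a , b) = a ≡ v ⊎ b ≡ v

    meets? : ∀ v → Decidable (Meets v)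
    meets? v (a , b) = (a ≟A v) ⊎-dec (b ≟A v)

    other : A → A × A → A
    other v (a , b) with a ≟A v
    ... | yes _ = b
    ... | no  _ = a

  independentSet′ : ∀ fuel (vs : List A) ps → length vs ≤ fuel → Unique vs →
    ∃[ xs ] Unique xs × (∀ {x} → x ∈ xs → x ∈ vs) × Independent ps xs ×
            8 * length vs ≤ 64 * length xs + length ps
  independentSet′ _ [] ps _ _ = [] , [] , id , (λ _ ()) , z≤n
  independentSet′ (suc fuel) (v ∷ vs) ps (s≤s ≤fuel) (v∉ ∷ u)
    with 8 ≤? length (filter (meets? v) ps)
  -- Discarding `v` adds 8 to the left side of the bound, and the pairs that meet `v`, at least 8,
  -- leave `ps` and pay for it.
  ... | yes many with independentSet′ fuel vs (filter (∁? (meets? v)) ps) ≤fuel u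
  ...   | xs , uxs , xs⊆ , ind , bound = xs , uxs , there ∘ xs⊆ , ind′ , (begin
    8 * suc (length vs)     ≡⟨ *-suc 8 (length vs) ⟩
    8 + 8 * length vs       ≤⟨ +-mono-≤ many bound ⟩
    length (filter (meets? v) ps) + (64 * length xs + length (filter (∁? (meets? v)) ps))
      ≡⟨ +-left-comm (length (filter (meets? v) ps)) (64 * length xs) _ ⟩
    64 * length xs + (length (filter (meets? v) ps) + length (filter (∁? (meets? v)) ps))
      ≡⟨ cong (_+_ (64 * length xs)) (length-filter-∁ (meets? v) ps) ⟩
    64 * length xs + length ps ∎)
    where
    open ≤-Reasoning
    v∉xs : v ∉ xs
    v∉xs v∈ = All¬⇒¬Any v∉ (xs⊆ v∈)
    ind′ : Independent ps xs
    ind′ ab∈ a∈ b∈ = ind (∈-filter⁺ (∁? (meets? v)) ab∈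
      λ { (inj₁ refl) → v∉xs a∈ ; (inj₂ refl) → v∉xs b∈ }) a∈ b∈
  -- Keeping `v` removes at most 8 vertices, worth 64 on the left, which the new element of `xs`
  -- pays for. The weights 8 and 64 come from these two trades.
  independentSet′ (suc fuel) (v ∷ vs) ps (s≤s ≤fuel) (v∉ ∷ u) | no few
    with independentSet′ fuel vs′ rest
           (≤-trans (m+n≤o⇒n≤o _ (≤-reflexive (length-filter-∁ (_∈? nbs) vs))) ≤fuel)
           (Uniq.filter⁺ (_∉? nbs) u)
    where
    nbs  = map (other v) (filter (meets? v) ps)
    vs′  = filter (_∉? nbs) vs
    rest = filter (∁? (meets? v)) ps
  ... | xs , uxs , xs⊆ , ind , bound =
      v ∷ xs , ¬Any⇒All¬ _ v∉xs ∷ uxs , (λ { (here px) → here px ; (there x∈) → there (xs⊆vs x∈) })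
    , ind′ , (begin
    8 * suc (length vs)              ≤⟨ *-monoʳ-≤ 8 (s≤s vs-bound) ⟩
    8 * suc (7 + length vs′)         ≡⟨ *-distribˡ-+ 8 8 (length vs′) ⟩
    64 + 8 * length vs′              ≤⟨ +-monoʳ-≤ 64 bound ⟩
    64 + (64 * length xs + length rest) ≤⟨ +-monoʳ-≤ 64 (+-monoʳ-≤ (64 * length xs)
                                             (m+n≤o⇒n≤o _ (≤-reflexive (length-filter-∁ (meets? v) ps)))) ⟩
    64 + (64 * length xs + length ps)   ≡⟨ +-assoc 64 (64 * length xs) (length ps) ⟨
    64 + 64 * length xs + length ps     ≡⟨ cong (_+ length ps) (*-suc 64 (length xs)) ⟨
    64 * suc (length xs) + length ps ∎)
    where
    open ≤-Reasoning
    nbs  = map (other v) (filter (meets? v) ps)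
    vs′  = filter (_∉? nbs) vs
    rest = filter (∁? (meets? v)) ps
    vs-bound : length vs ≤ 7 + length vs′
    vs-bound = begin
      length vs                  ≤⟨ unique-⊆⇒length-≤ u (λ {x} x∈ → split x x∈) ⟩
      length (nbs ++ vs′)        ≡⟨ length-++ nbs ⟩
      length nbs + length vs′    ≡⟨ cong (_+ length vs′) (length-map (other v) (filter (meets? v) ps)) ⟩
      length (filter (meets? v) ps) + length vs′ ≤⟨ +-monoˡ-≤ _ (≤-pred (≰⇒> few)) ⟩
      7 + length vs′             ∎
      where
      split : ∀ x → x ∈ vs → x ∈ nbs ++ vs′
      split x x∈ with x ∈? nbs
      ... | yes x∈nbs = ∈-++⁺ˡ x∈nbs
      ... | no  x∉nbs = ∈-++⁺ʳ nbs (∈-filter⁺ (_∉? nbs) x∈ x∉nbs)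
    xs⊆vs : ∀ {x} → x ∈ xs → x ∈ vs
    xs⊆vs x∈ = proj₁ (∈-filter⁻ (_∉? nbs) (xs⊆ x∈))
    v∉xs : v ∉ xs
    v∉xs v∈ = All¬⇒¬Any v∉ (xs⊆vs v∈)
    nbs∉ : ∀ {p} → p ∈ ps → Meets v p → other v p ∉ xs
    nbs∉ p∈ m o∈ = proj₂ (∈-filter⁻ (_∉? nbs) {xs = vs} (xs⊆ o∈)) (∈-map⁺ (other v) (∈-filter⁺ (meets? v) p∈ m))
    ind′ : Independent ps (v ∷ xs)
    ind′ ab∈ (here refl) (here refl) = refl
    ind′ {a} {b} ab∈ (here refl) (there b∈) with a ≟A a | nbs∉ ab∈ (inj₁ refl)
    ... | yes _ | b∉ = contradiction b∈ b∉
    ... | no ¬p | _  = contradiction refl ¬p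
    ind′ {a} {b} ab∈ (there a∈) (here refl) with a ≟A b | nbs∉ ab∈ (inj₂ refl)
    ... | yes a≡b | _ = a≡b
    ... | no _    | a∉ = contradiction a∈ a∉
    ind′ {a} {b} ab∈ (there a∈) (there b∈) with meets? v (a , b)
    ... | yes (inj₁ refl) = contradiction a∈ v∉xs
    ... | yes (inj₂ refl) = contradiction b∈ v∉xs
    ... | no ¬m = ind (∈-filter⁺ (∁? (meets? v)) ab∈ ¬m) a∈ b∈

  independentSet : ∀ (vs : List A) ps → Unique vs →
    ∃[ xs ] Unique xs × (∀ {x} → x ∈ xs → x ∈ vs) × Independent ps xs ×
            8 * length vs ≤ 64 * length xs + length ps
  independentSet vs ps = independentSet′ (length vs) vs ps ≤-refl

-- Paths and cycles

module Paths {n : ℕ} (H : Graph n) where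
  open Graph H

  private
    variable
      S : Pred Edge 0ℓ
      x y z : Fin n
      l m r : ℕ

  Joins-sym : ∀ {e} → Joins e x y → Joins e y x
  Joins-sym = swap

  Joins-unique : ∀ {e a b} → Joins e x y → Joins e a b → (x ≡ a × y ≡ b) ⊎ (x ≡ b × y ≡ a)
  Joins-unique (inj₁ p) (inj₁ q) with trans (sym p) q
  ... | refl = inj₁ (refl , refl)
  Joins-unique (inj₁ p) (inj₂ q) with trans (sym p) q
  ... | refl = inj₂ (refl , refl)
  Joins-unique (inj₂ p) (inj₁ q) with trans (sym p) q
  ... | refl = inj₂ (refl , refl)
  Joins-unique (inj₂ p) (inj₂ q) with trans (sym p) q
  ... | refl = inj₁ (refl , refl)

  -- These are walks: vertices and edges may repeat. The predicate `S` confines the edges, so an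
  -- edge outside `S` differs from all of them.
  data Path (S : Pred Edge 0ℓ) : ℕ → Fin n → Fin n → Set where
    stop : Path S 0 x x
    step : ∀ e → S e → Joins e x y → Path S l y z → Path S (suc l) x z

  path-map : {S′ : Pred Edge 0ℓ} → (∀ {e} → S e → S′ e) → Path S l x y → Path S′ l x y
  path-map f stop           = stop
  path-map f (step e s j p) = step e (f s) j (path-map f p)

  reverseOnto : Path S l x y → Path S m x z → Path S (l + m) y z
  reverseOnto stop q = q
  reverseOnto {S = S} {l = suc l} {y = y} {m = m} {z = z} (step e s j p) q =
    subst (λ i → Path S i y z) (+-suc l m) (reverseOnto p (step e s (Joins-sym j) q))

  meet : Path S l x z → Path S m y z → Path S (l + m) x y
  meet {S = S} {x = x} {m = m} {y = y} stop q =
    subst (λ i → Path S i x y) (+-identityʳ m) (reverseOnto q stop)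
  meet (step e s j p) q = step e s j (meet p q)

  vertices : Path S l x y → Fin (suc l) → Fin n
  vertices {x = x} stop           zero    = x
  vertices {x = x} (step _ _ _ p) zero    = x
  vertices         (step _ _ _ p) (suc i) = vertices p i

  vertices-zero : (p : Path S l x y) → vertices p zero ≡ x
  vertices-zero stop           = refl
  vertices-zero (step _ _ _ _) = refl

  vertices-last : (p : Path S l x y) → vertices p (fromℕ l) ≡ y
  vertices-last stop           = refl
  vertices-last (step _ _ _ p) = vertices-last p

  IsSimple : Path S l x y → Set
  IsSimple         stop           = ⊤
  IsSimple {x = x} (step _ _ _ p) = (∀ i → vertices p i ≢ x) × IsSimple p

  vertices-injective : (p : Path S l x y) → IsSimple p → Injective _≡_ _≡_ (vertices p)
  vertices-injective stop           _         {zero}  {zero}  _  = refl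
  vertices-injective (step _ _ _ p) _         {zero}  {zero}  _  = refl
  vertices-injective (step _ _ _ p) (x∉ , _)  {zero}  {suc j} eq = contradiction (sym eq) (x∉ j)
  vertices-injective (step _ _ _ p) (x∉ , _)  {suc i} {zero}  eq = contradiction eq (x∉ i)
  vertices-injective (step _ _ _ p) (_ , sp)  {suc i} {suc j} eq = cong suc (vertices-injective p sp eq)

  suffix : (p : Path S l x y) → IsSimple p → ∀ i →
           ∃[ m ] m ≤ l × Σ[ q ∈ Path S m (vertices p i) y ] IsSimple q
  suffix {l = l} stop           sp       zero    = _ , ≤-refl , stop , tt
  suffix {l = l} (step e s j p) sp       zero    = _ , ≤-refl , step e s j p , sp
  suffix         (step e s j p) (_ , sp) (suc i) with suffix p sp i
  ... | m , m≤ , q = m , m≤n⇒m≤1+n m≤ , q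

  -- If `x` already lies on the erased remainder of the walk, the part of the remainder from `x` on
  -- replaces the whole walk.
  loop-erase : Path S l x y → ∃[ m ] m ≤ l × Σ[ q ∈ Path S m x y ] IsSimple q
  loop-erase stop = 0 , z≤n , stop , tt
  loop-erase {x = x} (step e s j p) with loop-erase p
  ... | m , m≤ , q , sq with any? (λ i → vertices q i ≟ x)
  ...   | no  x∉       = suc m , s≤s m≤ , step e s j q , (λ i eq → x∉ (i , eq)) , sq
  ...   | yes (i , refl) with suffix q sq i
  ...     | k , k≤ , q′ = k , ≤-trans k≤ (m≤n⇒m≤1+n m≤) , q′

  closedEdges : Path S l x y → Edge → Fin (suc l) → Edge
  closedEdges stop           e zero    = e
  closedEdges (step f _ _ p) e zero    = f
  closedEdges (step f _ _ p) e (suc i) = closedEdges p e i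

  closedEdges-last : (p : Path S l x y) (e : Edge) → closedEdges p e (fromℕ l) ≡ e
  closedEdges-last stop           e = refl
  closedEdges-last (step f _ _ p) e = closedEdges-last p e

  closedEdges-step : (p : Path S l x y) (e : Edge) (i : Fin l) →
    Joins (closedEdges p e (inject₁ i)) (vertices p (inject₁ i)) (vertices p (suc i))
  closedEdges-step {x = x} (step f s j p) e zero = subst (Joins f x) (sym (vertices-zero p)) j
  closedEdges-step (step f s j p) e (suc i) = closedEdges-step p e i

  closedEdges-ends : (p : Path S l x y) (e : Edge) (i : Fin (suc l)) →
    closedEdges p e i ≡ e ⊎ ∃[ j ] ∃[ k ] Joins (closedEdges p e i) (vertices p j) (vertices p k)
  closedEdges-ends stop           e zero    = inj₁ refl
  closedEdges-ends q@(step f s j p) e zero  = inj₂ (zero , suc zero , closedEdges-step q e zero)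
  closedEdges-ends (step f s j p) e (suc i) with closedEdges-ends p e i
  ... | inj₁ eq          = inj₁ eq
  ... | inj₂ (a , b , J) = inj₂ (suc a , suc b , J)

  -- Every later edge is either the closing edge or has both ends on `p`, which avoids the end `x`
  -- of `f`.
  closedEdges-fresh : ∀ {e f} → e ≢ f → Joins f x y → (p : Path S l y z) →
    (∀ i → vertices p i ≢ x) → ∀ i → closedEdges p e i ≢ f
  closedEdges-fresh {e = e} e≢f J p x∉ i eq with closedEdges-ends p e i
  ... | inj₁ eq′ = e≢f (trans (sym eq′) eq)
  ... | inj₂ (a , b , J′) with Joins-unique J (subst (λ g → Joins g _ _) eq J′)
  ...   | inj₁ (x≡ , _) = x∉ a (sym x≡)
  ...   | inj₂ (x≡ , _) = x∉ b (sym x≡)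

  closedEdges-injective : (p : Path S l x y) → IsSimple p → ∀ {e} → ¬ S e →
                          Injective _≡_ _≡_ (closedEdges p e)
  closedEdges-injective stop _ _ {zero} {zero} _ = refl
  closedEdges-injective (step f s j p) _ e∉ {zero} {zero} _ = refl
  closedEdges-injective {S = S} (step f s j p) (x∉ , _) e∉ {zero} {suc i} eq =
    contradiction (sym eq) (closedEdges-fresh (λ e≡f → e∉ (subst S (sym e≡f) s)) j p x∉ i)
  closedEdges-injective {S = S} (step f s j p) (x∉ , _) e∉ {suc i} {zero} eq =
    contradiction eq (closedEdges-fresh (λ e≡f → e∉ (subst S (sym e≡f) s)) j p x∉ i)
  closedEdges-injective (step f s j p) (_ , sp) e∉ {suc i} {suc k} eq =
    cong suc (closedEdges-injective p sp e∉ eq)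

  ShortCycle : ℕ → Set
  ShortCycle b = Σ[ C ∈ Cycle H ] Cycle.cycleLength C ≤ b

  -- Loop erasure makes the vertices distinct and keeps the edges inside `S`. As `e` lies outside
  -- `S`, it is a new edge, and closing with it gives a cycle even in the presence of loops and
  -- parallel edges.
  close-path : ∀ {e} → ¬ S e → Joins e y x → Path S l x y → l < r → ShortCycle r
  close-path {e = e} e∉ J p l<r with loop-erase p
  ... | m , m≤ , q , sq = record
      { l          = m
      ; vertex     = vertices q
      ; edge       = closedEdges q e
      ; vertex-inj = vertices-injective q sq
      ; edge-inj   = closedEdges-injective q sq e∉
      ; step       = closedEdges-step q e
      ; close      = subst₂ (λ a b → Joins (closedEdges q e (fromℕ m)) a b)
                       (sym (vertices-last q)) (sym (vertices-zero q))
                       (subst (λ f → Joins f _ _) (sym (closedEdges-last q e)) J)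
      } , ≤-trans (s≤s m≤) l<r

-- Short cycles in graphs with more edges than vertices

module SparseGirth {n : ℕ} (H : Graph n) where
  open Graph H
  open Paths H
  open import Data.List.Membership.DecPropositional (_≟_ {n}) using (_∈?_; _∉?_)
  open import Data.List.Membership.DecPropositional (_≟_ {size}) using ()
    renaming (_∉?_ to _∉ᴱ?_; _∈?_ to _∈ᴱ?_)

  src tgt : Edge → Fin n
  src e = proj₁ (ends e)
  tgt e = proj₂ (ends e)

  module _ (body : List (Fin n)) where
    Touching Crossing : Edge → Set
    Touching e = src e ∈ body ⊎ tgt e ∈ body
    Crossing e = src e ∈ body × tgt e ∉ body ⊎ src e ∉ body × tgt e ∈ body

    touching? : Decidable Touching
    touching? e = (src e ∈? body) ⊎-dec (tgt e ∈? body)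

    crossing? : Decidable Crossing
    crossing? e = ((src e ∈? body) ×-dec (tgt e ∉? body)) ⊎-dec ((src e ∉? body) ×-dec (tgt e ∈? body))

    -- Meaningful for crossing edges only, where it is the end outside `body`.
    far : Edge → Fin n
    far e with src e ∈? body
    ... | yes _ = tgt e
    ... | no  _ = src e

    far-∉ : ∀ {e} → Crossing e → far e ∉ body
    far-∉ {e} cr with src e ∈? body | cr
    ... | yes _  | inj₁ (_ , t∉) = t∉
    ... | yes s∈ | inj₂ (s∉ , _) = contradiction s∈ s∉
    ... | no s∉  | _             = s∉

    far-joins : ∀ {e} → Crossing e → ∃[ x ] x ∈ body × Joins e (far e) x
    far-joins {e} cr with src e ∈? body | cr
    ... | yes s∈ | _             = src e , s∈ , inj₂ refl
    ... | no s∉  | inj₁ (s∈ , _) = contradiction s∈ s∉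
    ... | no _   | inj₂ (_ , t∈) = tgt e , t∈ , inj₁ refl

  -- A rooted tree of depth at most `r` inside the vertex set `U`. Since `reach` makes it connected,
  -- `body-size` forces `tree` to be a spanning tree of `body`.
  record Ball (U : List (Fin n)) (r : ℕ) : Set where
    field
      root        : Fin n
      body        : List (Fin n)
      tree        : List Edge
      body-unique : Unique body
      body⊆       : ∀ {x} → x ∈ body → x ∈ U
      body-size   : length body ≡ suc (length tree)
      tree-ends   : ∀ {e} → e ∈ tree → src e ∈ body × tgt e ∈ body
      reach       : ∀ {x} → x ∈ body → ∃[ l ] l ≤ r × Path (_∈ tree) l x root

    tree-joins : ∀ {e x y} → e ∈ tree → Joins e x y → x ∈ body
    tree-joins e∈ (inj₁ eq) = subst (_∈ body) (cong proj₁ eq) (proj₁ (tree-ends e∈))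
    tree-joins e∈ (inj₂ eq) = subst (_∈ body) (cong proj₂ eq) (proj₂ (tree-ends e∈))

  singleton : ∀ {U x} → x ∈ U → Ball U 0
  singleton {x = x} x∈ = record
    { root        = x
    ; body        = x ∷ []
    ; tree        = []
    ; body-unique = [] ∷ []
    ; body⊆       = λ { (here refl) → x∈ }
    ; body-size   = refl
    ; tree-ends   = λ ()
    ; reach       = λ { (here refl) → 0 , z≤n , stop }
    }

  module _ {U : List (Fin n)} {F : List Edge} (uF : Unique F)
           (F-ends : ∀ {e} → e ∈ F → src e ∈ U × tgt e ∈ U) {r : ℕ} (ball : Ball U r) where
    open Ball ball

    boundary : List Edge
    boundary = filter (crossing? body) F

    private
      crosses : ∀ {e} → e ∈ boundary → Crossing body e
      crosses e∈ = proj₂ (∈-filter⁻ (crossing? body) {xs = F} e∈)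


    -- The walks from both ends to the root use tree edges only, so `e` closes them to a cycle of
    -- length at most `2r + 1`. The stated bound is the one shared with collisions.
    chord⇒cycle : ∀ {e} → src e ∈ body → tgt e ∈ body → e ∉ tree → ShortCycle (2 + (r + r))
    chord⇒cycle s∈ t∈ e∉ with reach s∈ | reach t∈
    ... | l , l≤ , p | m , m≤ , q =
      close-path e∉ (inj₂ refl) (meet p q) (s≤s (m≤n⇒m≤1+n (+-mono-≤ l≤ m≤)))

    -- From the common far end the walk enters the ball by `f`, goes through the root to the inner
    -- end of `e`, and returns by `e`: at most `2r + 2` edges. The edge `e` is not in the tree
    -- because its far end is outside `body`.
    collision⇒cycle : ∀ {e f} → e ∈ boundary → f ∈ boundary → e ≢ f → far body e ≡ far body f →
                      ShortCycle (2 + (r + r))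
    collision⇒cycle {e} {f} e∈ f∈ e≢f eq
      with far-joins body (crosses e∈) | far-joins body (crosses f∈)
    ... | x , x∈ , Je | y , y∈ , Jf with reach x∈ | reach y∈
    ...   | l , l≤ , p | m , m≤ , q =
      close-path {S = λ g → g ≡ f ⊎ g ∈ tree}
        [ e≢f , (λ e∈T → far-∉ body (crosses e∈) (tree-joins e∈T Je)) ]′
        (Joins-sym (subst (λ z → Joins e z x) eq Je))
        (step f (inj₁ refl) Jf (path-map inj₂ (meet q p)))
        (s≤s (s≤s (+-mono-≤ m≤ l≤)))

    expand : Unique (map (far body) boundary) →
             Σ[ b ∈ Ball U (suc r) ] length (Ball.body b) ≡ length body + length boundary
    expand u-far = record
        { root        = root
        ; body        = body ++ layer
        ; tree        = tree ++ boundary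
        ; body-unique = Uniq.++⁺ body-unique u-far λ (x∈ , x∈′) → layer-∉ x∈′ x∈
        ; body⊆       = λ x∈ → [ body⊆ , layer⊆ ]′ (∈-++⁻ body x∈)
        ; body-size   = trans size′ (trans (cong (_+ length boundary) body-size)
                                           (cong suc (sym (length-++ tree))))
        ; tree-ends   = λ e∈ → [ old-ends , new-ends ]′ (∈-++⁻ tree e∈)
        ; reach       = λ x∈ → [ old-reach , new-reach ]′ (∈-++⁻ body x∈)
        } , size′
      where
      layer = map (far body) boundary
      size′ : length (body ++ layer) ≡ length body + length boundary
      size′ = trans (length-++ body) (cong (_+_ (length body)) (length-map (far body) boundary))
      layer-∉ : ∀ {x} → x ∈ layer → x ∉ body
      layer-∉ x∈ with ∈-map⁻ (far body) x∈
      ... | e , e∈ , refl = far-∉ body (crosses e∈)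
      layer⊆ : ∀ {x} → x ∈ layer → x ∈ U
      layer⊆ x∈ with ∈-map⁻ (far body) x∈
      ... | e , e∈ , refl with far-joins body (crosses e∈) | F-ends (proj₁ (∈-filter⁻ (crossing? body) e∈))
      ...   | _ , _ , inj₁ eq | s∈ , _ = subst (_∈ U) (cong proj₁ eq) s∈
      ...   | _ , _ , inj₂ eq | _ , t∈ = subst (_∈ U) (cong proj₂ eq) t∈
      old-ends : ∀ {e} → e ∈ tree → src e ∈ body ++ layer × tgt e ∈ body ++ layer
      old-ends e∈ with tree-ends e∈
      ... | s∈ , t∈ = ∈-++⁺ˡ s∈ , ∈-++⁺ˡ t∈
      new-ends : ∀ {e} → e ∈ boundary → src e ∈ body ++ layer × tgt e ∈ body ++ layer
      new-ends e∈ with far-joins body (crosses e∈) | ∈-++⁺ʳ body (∈-map⁺ (far body) e∈)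
      ... | x , x∈ , inj₁ eq | f∈ = subst (_∈ body ++ layer) (sym (cong proj₁ eq)) f∈
                                  , subst (_∈ body ++ layer) (sym (cong proj₂ eq)) (∈-++⁺ˡ x∈)
      ... | x , x∈ , inj₂ eq | f∈ = subst (_∈ body ++ layer) (sym (cong proj₁ eq)) (∈-++⁺ˡ x∈)
                                  , subst (_∈ body ++ layer) (sym (cong proj₂ eq)) f∈
      old-reach : ∀ {x} → x ∈ body → ∃[ l ] l ≤ suc r × Path (_∈ tree ++ boundary) l x root
      old-reach x∈ with reach x∈
      ... | l , l≤ , p = l , m≤n⇒m≤1+n l≤ , path-map ∈-++⁺ˡ p
      new-reach : ∀ {x} → x ∈ layer → ∃[ l ] l ≤ suc r × Path (_∈ tree ++ boundary) l x root
      new-reach x∈ with ∈-map⁻ (far body) x∈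
      ... | e , e∈ , refl with far-joins body (crosses e∈)
      ...   | y , y∈ , J with reach y∈
      ...     | l , l≤ , p = suc l , s≤s l≤ , step e (∈-++⁺ʳ tree e∈) J (path-map ∈-++⁺ˡ p)

    -- Without chords, every edge of `F` that touches the ball is a tree edge or a boundary edge.
    -- Without collisions, each boundary edge brings a new vertex of its own, so the next layer
    -- again gives a tree.
    expand-or-cycle : ShortCycle (2 + (r + r)) ⊎
      (length (filter (touching? body) F) ≤ length tree + length boundary ×
       Σ[ b ∈ Ball U (suc r) ] length (Ball.body b) ≡ length body + length boundary)
    expand-or-cycle with Any.any? (λ e → (src e ∈? body) ×-dec (tgt e ∈? body) ×-dec (e ∉ᴱ? tree)) F
    ... | yes chord with find chord
    ...   | e , _ , s∈ , t∈ , e∉ = inj₁ (chord⇒cycle s∈ t∈ e∉)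
    expand-or-cycle | no no-chord
      with unique-map⊎collision _≟_ (far body) (Uniq.filter⁺ (crossing? body) uF)
    ... | inj₂ (e , f , e∈ , f∈ , e≢f , eq) = inj₁ (collision⇒cycle e∈ f∈ e≢f eq)
    ... | inj₁ u-far = inj₂ (subst (length (filter (touching? body) F) ≤_) (length-++ tree)
            (unique-⊆⇒length-≤ (Uniq.filter⁺ (touching? body) uF) touch⊆) , expand u-far)
      where
      touch⊆ : ∀ {e} → e ∈ filter (touching? body) F → e ∈ tree ++ boundary
      touch⊆ {e} e∈ with ∈-filter⁻ (touching? body) {xs = F} e∈ | src e ∈? body | tgt e ∈? body | e ∈ᴱ? tree
      ... | _           | _      | _      | yes e∈T = ∈-++⁺ˡ e∈T
      ... | e∈F , _     | yes s∈ | yes t∈ | no e∉T  = contradiction (lose e∈F (s∈ , t∈ , e∉T)) no-chord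
      ... | e∈F , _     | yes s∈ | no t∉  | no _    =
          ∈-++⁺ʳ tree (∈-filter⁺ (crossing? body) e∈F (inj₁ (s∈ , t∉)))
      ... | e∈F , _     | no s∉  | yes t∈ | no _    =
          ∈-++⁺ʳ tree (∈-filter⁺ (crossing? body) e∈F (inj₂ (s∉ , t∈)))
      ... | _ , inj₁ s∈ | no s∉  | no _   | no _    = contradiction s∈ s∉
      ... | _ , inj₂ t∈ | no _   | no t∉  | no _    = contradiction t∈ t∉

  -- `exhausts` says that `(1 + 1/A) ^ R` exceeds `(A + N) / A`: a quantity that starts at `A` or
  -- more and gains a factor `1 + 1/A` in each of `R` steps outgrows `A + N`.
  module _ (A R N : ℕ) (exhausts : A ^ R * (A + N) < suc A ^ R * A) where

    ShortCycle-mono : ∀ {a b} → a ≤ b → ShortCycle a → ShortCycle b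
    ShortCycle-mono a≤b (C , len) = C , ≤-trans len a≤b

    module _ {U : List (Fin n)} {F : List Edge} (uF : Unique F) (U≤N : length U ≤ N)
             (F-ends : ∀ {e} → e ∈ F → src e ∈ U × tgt e ∈ U) where

      -- Deleting such a ball keeps the density |F| / |U| above 1 + 1/A.
      Peelable : Set
      Peelable = ∃[ r ] Σ[ ball ∈ Ball U r ]
        A * length (filter (touching? (Ball.body ball)) F) ≤ suc A * length (Ball.body ball)

      -- A ball that is not peelable grows: A + |body| gains a factor 1 + 1/A.
      inflate : ∀ k r → k + r ≡ R → (ball : Ball U r) →
                suc A ^ r * A ≤ A ^ r * (A + length (Ball.body ball)) →
                ShortCycle (2 + (R + R)) ⊎ Peelable
      inflate zero r refl ball big = contradiction exhausts (≤⇒≯ (begin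
        suc A ^ r * A                       ≤⟨ big ⟩
        A ^ r * (A + length body)
          ≤⟨ *-monoʳ-≤ (A ^ r) (+-monoʳ-≤ A (≤-trans (unique-⊆⇒length-≤ body-unique body⊆) U≤N)) ⟩
        A ^ r * (A + N)                     ∎))
        where
        open Ball ball
        open ≤-Reasoning
      inflate (suc k) r k+r≡R ball big
        with A * length (filter (touching? (Ball.body ball)) F) ≤? suc A * length (Ball.body ball)
           | expand-or-cycle uF F-ends ball
      ... | yes peel | _      = inj₂ (r , ball , peel)
      ... | no _  | inj₁ cycle = inj₁ (ShortCycle-mono (s≤s (s≤s (+-mono-≤ r≤R r≤R))) cycle)
        where
        r≤R : r ≤ R
        r≤R = subst (r ≤_) k+r≡R (m≤n+m r (suc k))
      ... | no ¬peel | inj₂ (touch≤ , ball′ , size′) =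
        inflate k (suc r) (trans (+-suc k r) k+r≡R) ball′ (begin
          suc A * suc A ^ r * A      ≡⟨ *-assoc (suc A) (suc A ^ r) A ⟩
          suc A * (suc A ^ r * A)    ≤⟨ *-monoʳ-≤ (suc A) big ⟩
          suc A * (A ^ r * (A + length body)) ≡⟨ expand₁ A (A ^ r) (length body) ⟩
          A ^ r * (A * A + A * length body + (A + length body))
            ≤⟨ *-monoʳ-≤ (A ^ r) (+-monoʳ-≤ (A * A + A * length body) (<⇒≤ gain)) ⟩
          A ^ r * (A * A + A * length body + A * length ∂) ≡⟨ expand₂ A (A ^ r) (length body) (length ∂) ⟩
          A * A ^ r * (A + (length body + length ∂)) ≡⟨ cong (λ s → A * A ^ r * (A + s)) size′ ⟨
          A * A ^ r * (A + length (Ball.body ball′)) ∎)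
        where
        open Ball ball
        open ≤-Reasoning
        ∂ = boundary uF F-ends ball
        expand₁ : ∀ a p b → suc a * (p * (a + b)) ≡ p * (a * a + a * b + (a + b))
        expand₁ = solve-∀
        expand₂ : ∀ a p b d → p * (a * a + a * b + a * d) ≡ a * p * (a + (b + d))
        expand₂ = solve-∀
        expand₃ : ∀ a t → a * t + (a + suc t) ≡ suc a * suc t
        expand₃ = solve-∀
        -- More than `suc A * |body|` is available from `A` times the touching edges. The tree, with
        -- one edge fewer than vertices, takes `A * |body| - A` of it, and at least `A + |body|`
        -- remains for the boundary. This is why the invariant measures `A + |body|`.
        gain : A + length body < A * length ∂
        gain = +-cancelˡ-< (A * length tree) _ _ (begin-strict
          A * length tree + (A + length body)         ≡⟨ cong (λ s → A * length tree + (A + s)) body-size ⟩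
          A * length tree + (A + suc (length tree))   ≡⟨ expand₃ A (length tree) ⟩
          suc A * suc (length tree)                   ≡⟨ cong (suc A *_) body-size ⟨
          suc A * length body                         <⟨ ≰⇒> ¬peel ⟩
          A * length (filter (touching? body) F)      ≤⟨ *-monoʳ-≤ A touch≤ ⟩
          A * (length tree + length ∂)                ≡⟨ *-distribˡ-+ A (length tree) (length ∂) ⟩
          A * length tree + A * length ∂              ∎)

    -- Peelable balls are deleted as long as they occur. Each deletion shrinks `U` and preserves the
    -- strict density inequality, which fails once `F` is empty, so a cycle must turn up before.
    sparse-girth′ : ∀ fuel (U : List (Fin n)) (F : List Edge) → length U ≤ fuel → length U ≤ N →
      Unique U → Unique F → (∀ {e} → e ∈ F → src e ∈ U × tgt e ∈ U) →
      suc A * length U < A * length F → ShortCycle (2 + (R + R))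
    sparse-girth′ _ U [] _ _ _ _ _ dense = contradiction (<-≤-trans dense (≤-reflexive (*-zeroʳ A))) (λ ())
    sparse-girth′ zero [] (e ∷ F) _ _ _ _ F-ends _ = contradiction (proj₁ (F-ends (here refl))) (λ ())
    sparse-girth′ (suc fuel) U F@(e ∷ _) U≤fuel U≤N uU uF F-ends dense
      with inflate uF U≤N F-ends R 0 (+-identityʳ R) (singleton (proj₁ (F-ends (here refl))))
             (*-monoʳ-≤ 1 (m≤m+n A 1))
    ... | inj₁ cycle = cycle
    ... | inj₂ (r , ball , peel) = sparse-girth′ fuel U′ F′
            (≤-pred (≤-trans U′<U U≤fuel)) (≤-trans (<⇒≤ U′<U) U≤N)
            (Uniq.filter⁺ (_∉? body) uU) (Uniq.filter⁺ (∁? (touching? body)) uF) F′-ends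
            (+-cancelˡ-< (suc A * length body) _ _ (begin-strict
              suc A * length body + suc A * length U′ ≡⟨ *-distribˡ-+ (suc A) (length body) (length U′) ⟨
              suc A * (length body + length U′)       ≤⟨ *-monoʳ-≤ (suc A) U-split ⟩
              suc A * length U                        <⟨ dense ⟩
              A * length F                            ≡⟨ cong (A *_) (length-filter-∁ (touching? body) F) ⟨
              A * (length (filter (touching? body) F) + length F′) ≡⟨ *-distribˡ-+ A _ (length F′) ⟩
              A * length (filter (touching? body) F) + A * length F′ ≤⟨ +-monoˡ-≤ (A * length F′) peel ⟩
              suc A * length body + A * length F′     ∎))
      where
      open Ball ball
      open ≤-Reasoning
      U′ = filter (_∉? body) U
      F′ = filter (∁? (touching? body)) F
      U-split : length body + length U′ ≤ length U
      U-split = unique-⊆⇒length-filter-∉ _≟_ body-unique body⊆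
      U′<U : length U′ < length U
      U′<U = ≤-trans (+-monoˡ-≤ (length U′) (subst (1 ≤_) (sym body-size) (s≤s z≤n))) U-split
      F′-ends : ∀ {e} → e ∈ F′ → src e ∈ U′ × tgt e ∈ U′
      F′-ends e∈ with ∈-filter⁻ (∁? (touching? body)) e∈
      ... | e∈F , ¬t with F-ends e∈F
      ...   | s∈ , t∈ = ∈-filter⁺ (_∉? body) s∈ (¬t ∘ inj₁) , ∈-filter⁺ (_∉? body) t∈ (¬t ∘ inj₂)

    -- All edges live on at most `n - |X|` vertices. Since `|X| > n / A`, having `n` edges there
    -- means a density above `1 + 1/A`.
    sparse-girth : (X : List (Fin n)) → Unique X → (∀ e → src e ∉ X × tgt e ∉ X) →
      n ≤ N → n ≤ size → n < A * length X → ShortCycle (2 + (R + R))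
    sparse-girth X uX avoids n≤N n≤size n<A|X| =
      sparse-girth′ n U (allFin size) U≤n (≤-trans U≤n n≤N)
        (Uniq.filter⁺ (_∉? X) (Uniq.allFin⁺ n)) (Uniq.allFin⁺ size)
        (λ {e} _ → ∈-filter⁺ (_∉? X) (∈-allFin (src e)) (proj₁ (avoids e))
                 , ∈-filter⁺ (_∉? X) (∈-allFin (tgt e)) (proj₂ (avoids e)))
        (begin-strict
          length U + A * length U          <⟨ +-monoˡ-< (A * length U) (≤-<-trans U≤n n<A|X|) ⟩
          A * length X + A * length U      ≡⟨ *-distribˡ-+ A (length X) (length U) ⟨
          A * (length X + length U)        ≤⟨ *-monoʳ-≤ A X+U≤n ⟩
          A * n                            ≤⟨ *-monoʳ-≤ A n≤size ⟩
          A * size                         ≡⟨ cong (A *_) (length-allFin size) ⟨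
          A * length (allFin size)         ∎)
      where
      open ≤-Reasoning
      U = filter (_∉? X) (allFin n)
      X+U≤n : length X + length U ≤ n
      X+U≤n = subst (length X + length U ≤_) (length-allFin n)
                (unique-⊆⇒length-filter-∉ _≟_ uX (λ {x} _ → ∈-allFin x))
      U≤n : length U ≤ n
      U≤n = m+n≤o⇒n≤o (length X) X+U≤n

-- Domination

∃-above-average : (f : A → ℕ) (x : A) (xs : List A) →
  ∃[ y ] y ∈ x ∷ xs × sum (map f (x ∷ xs)) ≤ length (x ∷ xs) * f y
∃-above-average f x [] = x , here refl , ≤-refl
∃-above-average f x (x′ ∷ xs) with ∃-above-average f x′ xs
... | y , y∈ , le with ≤-total (f x) (f y)
...   | inj₁ fx≤ = y , there y∈ , +-mono-≤ fx≤ le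
...   | inj₂ fy≤ = x , here refl , +-monoʳ-≤ (f x) (≤-trans le (*-monoʳ-≤ (suc (length xs)) fy≤))

-- Greedy domination: u is dominated by w when R u w, and every vertex of W has at
-- least d dominators in W.  Among the vertices of U left to dominate, some w ∈ W
-- dominates a fraction d / |W|, so |W| / d picks halve U.
module Domination {A : Set} {R : A → A → Set} (R? : ∀ u w → Dec (R u w)) (W : List A) (d : ℕ) where

  dominatedBy : List A → A → ℕ
  dominatedBy U w = length (filter (λ u → R? u w) U)

  Rich : List A → Set
  Rich U = ∀ {u} → u ∈ U → d ≤ length (filter (R? u) W)

  Dominates : List A → A → Set
  Dominates Y u = ∃[ y ] y ∈ Y × R u y

  sum-dominatedBy-∷ : ∀ u U V → sum (map (dominatedBy (u ∷ U)) V) ≡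
                      length (filter (R? u) V) + sum (map (dominatedBy U) V)
  sum-dominatedBy-∷ u U [] = refl
  sum-dominatedBy-∷ u U (v ∷ V) with R? u v
  ... | yes _ = cong suc (trans (cong (_+_ (dominatedBy U v)) (sum-dominatedBy-∷ u U V))
      (+-left-comm (dominatedBy U v) (length (filter (R? u) V)) _))
  ... | no _  = trans (cong (_+_ (dominatedBy U v)) (sum-dominatedBy-∷ u U V))
      (+-left-comm (dominatedBy U v) (length (filter (R? u) V)) _)

  double-count : ∀ U → Rich U → length U * d ≤ sum (map (dominatedBy U) W)
  double-count [] _ = z≤n
  double-count (u ∷ U) rich = begin
    d + length U * d
      ≤⟨ +-mono-≤ (rich (here refl)) (double-count U (rich ∘ there)) ⟩
    length (filter (R? u) W) + sum (map (dominatedBy U) W)       ≡⟨ sum-dominatedBy-∷ u U W ⟨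
    sum (map (dominatedBy (u ∷ U)) W)                            ∎
    where open ≤-Reasoning

  pick : ∀ {w₀} → w₀ ∈ W → ∀ U → Rich U → ∃[ w ] w ∈ W × length U * d ≤ length W * dominatedBy U w
  pick w₀∈ U rich = go W refl w₀∈
    where
    go : ∀ V → V ≡ W → ∀ {w₀} → w₀ ∈ V → ∃[ w ] w ∈ W × length U * d ≤ length W * dominatedBy U w
    go (v ∷ V) refl _ with ∃-above-average (dominatedBy U) v V
    ... | w , w∈ , le = w , w∈ , ≤-trans (double-count U rich) le

  -- A stage of the greedy choice. The number `b` is a budget and may be underspent, so a stage can
  -- stay idle once few vertices are left.
  record Partial (U : List A) (b : ℕ) : Set where
    field
      chosen    : List A
      left      : List A
      chosen⊆   : ∀ {y} → y ∈ chosen → y ∈ W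
      cost      : length chosen ≤ b
      left⊆     : ∀ {u} → u ∈ left → u ∈ U
      dominates : ∀ {u} → u ∈ U → u ∈ left ⊎ Dominates chosen u

  idle : ∀ U b → Partial U b
  idle U b = record { chosen = [] ; left = U ; chosen⊆ = λ () ; cost = z≤n ; left⊆ = id ; dominates = inj₁ }

  _then_ : ∀ {U b b′} (p : Partial U b) → Partial (Partial.left p) b′ → Partial U (b + b′)
  _then_ {U} p q = record
    { chosen    = P.chosen ++ Q.chosen
    ; left      = Q.left
    ; chosen⊆   = λ y∈ → [ P.chosen⊆ , Q.chosen⊆ ]′ (∈-++⁻ P.chosen y∈)
    ; cost      = ≤-trans (≤-reflexive (length-++ P.chosen)) (+-mono-≤ P.cost Q.cost)
    ; left⊆     = P.left⊆ ∘ Q.left⊆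
    ; dominates = dom
    }
    where
    module P = Partial p
    module Q = Partial q
    dom : ∀ {u} → u ∈ U → u ∈ Q.left ⊎ Dominates (P.chosen ++ Q.chosen) u
    dom u∈ with P.dominates u∈
    ... | inj₂ (y , y∈ , r) = inj₂ (y , ∈-++⁺ˡ y∈ , r)
    ... | inj₁ u∈′ with Q.dominates u∈′
    ...   | inj₂ (y , y∈ , r) = inj₂ (y , ∈-++⁺ʳ P.chosen y∈ , r)
    ...   | inj₁ u∈″ = inj₁ u∈″

  single : ∀ {w} → w ∈ W → ∀ U → Partial U 1
  single {w} w∈ U = record
    { chosen    = w ∷ []
    ; left      = filter (∁? (λ u → R? u w)) U
    ; chosen⊆   = λ { (here refl) → w∈ }
    ; cost      = ≤-refl
    ; left⊆     = λ u∈ → proj₁ (∈-filter⁻ (∁? (λ u → R? u w)) u∈)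
    ; dominates = dom
    }
    where
    dom : ∀ {u} → u ∈ U → u ∈ filter (∁? (λ u → R? u w)) U ⊎ Dominates (w ∷ []) u
    dom {u} u∈ with R? u w
    ... | yes r = inj₂ (w , here refl , r)
    ... | no ¬r = inj₁ (∈-filter⁺ (∁? (λ u → R? u w)) u∈ ¬r)

  module _ {w₀ : A} (w₀∈ : w₀ ∈ W) where

    -- As long as more than `h` vertices are left, a pick by averaging dominates at least
    -- `h * d / |W|` of them. The second alternative is the total after `b` such picks, multiplied
    -- by `|W|`.
    thin : ∀ h b U → Rich U → Σ[ p ∈ Partial U b ]
      (length (Partial.left p) ≤ h ⊎ length W * length (Partial.left p) + b * (h * d) ≤ length W * length U)
    thin h zero U rich = idle U 0 , inj₂ (≤-reflexive (+-identityʳ _))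
    thin h (suc b) U rich with length U ≤? h | pick w₀∈ U rich
    ... | yes U≤h | _ = idle U (suc b) , inj₁ U≤h
    ... | no U≰h | w , w∈ , le with thin h b (filter (∁? (λ u → R? u w)) U)
                                     (rich ∘ Partial.left⊆ (single w∈ U))
    ...   | q , inj₁ small = single w∈ U then q , inj₁ small
    ...   | q , inj₂ drop  = single w∈ U then q , inj₂ (begin
      ω * length (Partial.left q) + (h * d + b * (h * d))
        ≡⟨ +-left-comm (ω * length (Partial.left q)) (h * d) _ ⟩
      h * d + (ω * length (Partial.left q) + b * (h * d))
        ≤⟨ +-mono-≤ (≤-trans (*-monoˡ-≤ d (<⇒≤ (≰⇒> U≰h))) le) drop ⟩
      ω * dominatedBy U w + ω * length U′              ≡⟨ *-distribˡ-+ ω (dominatedBy U w) _ ⟨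
      ω * (dominatedBy U w + length U′)                ≡⟨ cong (ω *_) (length-filter-∁ (λ u → R? u w) U) ⟩
      ω * length U                                      ∎)
      where
      open ≤-Reasoning
      ω = length W
      U′ = filter (∁? (λ u → R? u w)) U

    module _ (a : ℕ) (W≤ : length W ≤ a * d) where

      -- As `|W| ≤ a * d`, the `a` picks remove at least `h` of the at most `2 * h` vertices, unless
      -- `h` or fewer are left earlier.
      halve : ∀ h U → Rich U → length U ≤ 2 * h →
              Σ[ p ∈ Partial U a ] length (Partial.left p) ≤ h
      halve h U rich U≤ with thin h a U rich
      ... | p , inj₁ small = p , small
      ... | p , inj₂ drop  = p , *-cancelˡ-≤ ω ⦃ >-nonZero (∈-length w₀∈) ⦄ (+-cancelʳ-≤ (ω * h) _ _ (begin
        ω * length (Partial.left p) + ω * h       ≤⟨ +-monoʳ-≤ _ (*-monoˡ-≤ h W≤) ⟩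
        ω * length (Partial.left p) + a * d * h   ≡⟨ cong (_+_ (ω * length (Partial.left p))) (rotate a d h) ⟩
        ω * length (Partial.left p) + a * (h * d) ≤⟨ drop ⟩
        ω * length U                              ≤⟨ *-monoʳ-≤ ω U≤ ⟩
        ω * (2 * h)                               ≡⟨ double ω h ⟩
        ω * h + ω * h                             ∎))
        where
        open ≤-Reasoning
        ω = length W
        rotate : ∀ a d h → a * d * h ≡ a * (h * d)
        rotate = solve-∀
        double : ∀ a h → a * (2 * h) ≡ a * h + a * h
        double = solve-∀

      halve-repeatedly : ∀ j h U → Rich U → length U ≤ 2 ^ j * h →
                         Σ[ p ∈ Partial U (j * a) ] length (Partial.left p) ≤ h
      halve-repeatedly zero    h U rich U≤ = idle U 0 , ≤-trans U≤ (≤-reflexive (*-identityˡ h))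
      halve-repeatedly (suc j) h U rich U≤
        with halve (2 ^ j * h) U rich (≤-trans U≤ (≤-reflexive (*-assoc 2 (2 ^ j) h)))
      ... | p , small with halve-repeatedly j h (Partial.left p) (rich ∘ Partial.left⊆ p) small
      ...   | q , small′ = p then q , small′

      -- The remaining vertices each receive a dominator of their own; one exists because `d` is
      -- positive.
      finish : 1 ≤ d → ∀ U → Rich U → Σ[ p ∈ Partial U (length U) ] Partial.left p ≡ []
      finish 1≤d [] rich = idle [] 0 , refl
      finish 1≤d (u ∷ U) rich with filter (R? u) W in eq | rich (here refl)
      ... | [] | d≤0 = contradiction (≤-trans 1≤d d≤0) (λ ())
      ... | w ∷ ws | _ with finish 1≤d U (rich ∘ there)
                          | ∈-filter⁻ (R? u) {xs = W} (subst (w ∈_) (sym eq) (here refl))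
      ...   | p , left≡[] | w∈ , r = record
        { chosen    = w ∷ P.chosen
        ; left      = []
        ; chosen⊆   = λ { (here refl) → w∈ ; (there y∈) → P.chosen⊆ y∈ }
        ; cost      = s≤s P.cost
        ; left⊆     = λ ()
        ; dominates = dom
        } , refl
        where
        module P = Partial p
        dom : ∀ {v} → v ∈ u ∷ U → v ∈ [] ⊎ Dominates (w ∷ P.chosen) v
        dom (here refl) = inj₂ (w , here refl , r)
        dom (there v∈) with P.dominates v∈
        ... | inj₁ v∈left = inj₁ (subst (_ ∈_) left≡[] v∈left)
        ... | inj₂ (y , y∈ , r′) = inj₂ (y , there y∈ , r′)

      -- There are `j` halvings at `a` picks each, and then single picks for the last `h` vertices.
      dominating-set : 1 ≤ d → ∀ j h → Rich W → length W ≤ 2 ^ j * h →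
        ∃[ Y ] (∀ {y} → y ∈ Y → y ∈ W) × length Y ≤ j * a + h × (∀ {u} → u ∈ W → Dominates Y u)
      dominating-set 1≤d j h rich W≤2^jh with halve-repeatedly j h W rich W≤2^jh
      ... | p , small with finish 1≤d (Partial.left p) (rich ∘ Partial.left⊆ p)
      ...   | q , left≡[] = PQ.chosen , PQ.chosen⊆ , ≤-trans PQ.cost (+-monoʳ-≤ (j * a) small)
                          , λ u∈ → [ (λ u∈left → contradiction (subst (_ ∈_) left≡[] u∈left) λ ()) , id ]′
                                  (PQ.dominates u∈)
        where module PQ = Partial (p then q)

-- Cycles of a function, and cycles of distinct colours

module Orbit {n : ℕ} (g : Fin n → Fin n) (Y : List (Fin n)) (g-closed : ∀ {y} → y ∈ Y → g y ∈ Y) where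

  orbit : Fin n → ℕ → Fin n
  orbit x = fold x g

  orbit-∈ : ∀ {x} i → x ∈ Y → orbit x i ∈ Y
  orbit-∈ zero    x∈ = x∈
  orbit-∈ (suc i) x∈ = g-closed (orbit-∈ i x∈)

  orbit-shift : ∀ x {i j} → i ≤ j → orbit (orbit x i) (j ∸ i) ≡ orbit x j
  orbit-shift x {i} {j} i≤j = trans (sym (fold-+ x g (j ∸ i))) (cong (orbit x) (m∸n+n≡m i≤j))

  SimpleOrbit : ℕ → Set
  SimpleOrbit p = ∃[ x ] x ∈ Y × orbit x (suc p) ≡ x × Injective _≡_ _≡_ (λ (i : Fin (suc p)) → orbit x (toℕ i))

  -- A repetition at positions `i < j ≤ p` gives `orbit x i` the period `j - i`, shorter than
  -- `suc p`, so descent ends at an orbit without repetition. Periods are recorded by their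
  -- predecessors, hence the `∸ suc`.
  minimal-period : ∀ fuel p → p ≤ fuel → ∀ {x} → x ∈ Y → orbit x (suc p) ≡ x →
                   ∃[ q ] q ≤ p × SimpleOrbit q
  minimal-period fuel p p≤ {x} x∈ per
    with any? (λ (i : Fin (suc p)) → any? (λ (j : Fin (suc p)) →
           (toℕ i <? toℕ j) ×-dec (orbit x (toℕ i) ≟ orbit x (toℕ j))))
  ... | no ¬rep = p , ≤-refl , x , x∈ , per , inj
    where
    inj : Injective _≡_ _≡_ (λ (i : Fin (suc p)) → orbit x (toℕ i))
    inj {i} {j} eq with <-cmp (toℕ i) (toℕ j)
    ... | tri< i<j _ _ = contradiction (i , j , i<j , eq) ¬rep
    ... | tri≈ _ i≡j _ = toℕ-injective i≡j
    ... | tri> _ _ j<i = contradiction (j , i , j<i , sym eq) ¬rep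
  minimal-period zero zero _ x∈ per | yes (zero , zero , () , _)
  minimal-period (suc fuel) p p≤ {x} x∈ per | yes (i , j , i<j , eq)
    with minimal-period fuel (toℕ j ∸ suc (toℕ i)) (≤-pred (≤-trans shrink p≤)) (orbit-∈ (toℕ i) x∈)
           (trans (cong (orbit (orbit x (toℕ i))) (sym (+-∸-assoc 1 i<j)))
                  (trans (orbit-shift x (<⇒≤ i<j)) (sym eq)))
    where
    shrink : toℕ j ∸ suc (toℕ i) < p
    shrink = ≤-trans (s≤s (∸-monoʳ-≤ (toℕ j) (s≤s z≤n)))
      (≤-trans (≤-reflexive (sym (+-∸-assoc 1 (≤-trans (s≤s z≤n) i<j)))) (≤-pred (toℕ<n j)))
  ... | q , q≤ , o = q , ≤-trans q≤ (≤-trans (m∸n≤m (toℕ j) (suc (toℕ i))) (≤-pred (toℕ<n j))) , o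

  simple-orbit : ∀ {y} → y ∈ Y → ∃[ p ] p < length Y × SimpleOrbit p
  -- The pigeonholes are the positions in `Y`, of which there are `length Y` even if entries repeat.
  simple-orbit {y} y∈ with pigeonhole ≤-refl (λ (i : Fin (suc (length Y))) → Any.index (orbit-∈ (toℕ i) y∈))
  ... | i , j , i<j , same
    with minimal-period _ (toℕ j ∸ suc (toℕ i)) ≤-refl (orbit-∈ (toℕ i) y∈)
           (trans (cong (orbit (orbit y (toℕ i))) (sym (+-∸-assoc 1 i<j)))
             (trans (orbit-shift y (<⇒≤ i<j)) (sym eq)))
    where
    eq : orbit y (toℕ i) ≡ orbit y (toℕ j)
    eq = trans (lookup-index (orbit-∈ (toℕ i) y∈))
           (trans (cong (lookup Y) same) (sym (lookup-index (orbit-∈ (toℕ j) y∈))))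
  ... | q , q≤ , o = q , ≤-trans (s≤s q≤) (≤-trans (≤-reflexive (sym (+-∸-assoc 1 i<j)))
                       (≤-trans (m∸n≤m (toℕ j) (toℕ i)) (≤-pred (toℕ<n j)))) , o

module _ {n a : ℕ} (G : Graph n) (c : Graph.Edge G → Fin a) where
  open Graph G

  RainbowCycle : ℕ → Set
  RainbowCycle b = Σ[ C ∈ Cycle G ] Rainbow {G = G} c C × Cycle.cycleLength C ≤ b

  widen : ∀ {a b} → a ≤ b → RainbowCycle a → RainbowCycle b
  widen a≤b (C , rainbow , len) = C , rainbow , ≤-trans len a≤b

  -- Different vertices of `Y` are left in different colours. An orbit of `g` without repetition
  -- therefore has distinct edges and is rainbow for the same reason.
  functional-cycle : (Y : List (Fin n)) (g : Fin n → Fin n) (out : Fin n → Edge) →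
    (∀ {y} → y ∈ Y → g y ∈ Y) → (∀ {y} → y ∈ Y → Joins (out y) y (g y)) →
    (∀ {x y} → x ∈ Y → y ∈ Y → c (out x) ≡ c (out y) → x ≡ y) →
    ∀ {y} → y ∈ Y → RainbowCycle (length Y)
  functional-cycle Y g out closed joins own y∈ with Orbit.simple-orbit g Y closed y∈
  ... | p , p< , x , x∈ , per , inj = C , rainbow , p<
    where
    open Orbit g Y closed
    at : Fin (suc p) → Fin n
    at i = orbit x (toℕ i)
    at∈ : ∀ i → at i ∈ Y
    at∈ i = orbit-∈ (toℕ i) x∈
    C : Cycle G
    C = record
      { l          = p
      ; vertex     = at
      ; edge       = out ∘ at
      ; vertex-inj = inj
      ; edge-inj   = λ {i} {j} eq → inj (own (at∈ i) (at∈ j) (cong c eq))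
      ; step       = λ j → subst (Joins (out (at (inject₁ j))) (at (inject₁ j)))
                             (cong (orbit x) (cong suc (toℕ-inject₁ j))) (joins (at∈ (inject₁ j)))
      ; close      = subst (Joins (out (at (fromℕ p))) (at (fromℕ p)))
                             (trans (cong (orbit x ∘ suc) (toℕ-fromℕ p)) per) (joins (at∈ (fromℕ p)))
      }
    rainbow : Rainbow {G = G} c C
    rainbow _ _ (i , refl) (j , refl) e≢f same =
      e≢f (cong out (own (at∈ i) (at∈ j) same))

  -- `H` keeps one edge of each colour, so each of its cycles is rainbow in `G`, and only its length
  -- matters.
  recolour-cycle : (h : Fin a → Edge) → (∀ i → c (h i) ≡ i) →
    let H = record { size = a ; ends = ends ∘ h } in
    ∀ {b} → Paths.ShortCycle H b → RainbowCycle b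
  recolour-cycle h ch (C , len) = C′ , rainbow , len
    where
    open Cycle C
    h-inj : ∀ {i j} → h i ≡ h j → i ≡ j
    h-inj {i} {j} eq = trans (sym (ch i)) (trans (cong c eq) (ch j))
    C′ : Cycle G
    C′ = record { l = l ; vertex = vertex ; edge = h ∘ edge ; vertex-inj = vertex-inj
                ; edge-inj = edge-inj ∘ h-inj ; step = step ; close = close }
    rainbow : Rainbow {G = G} c C′
    rainbow _ _ (i , refl) (j , refl) e≢f same =
      e≢f (cong h (trans (sym (ch (edge i))) (trans same (ch (edge j)))))

-- Arithmetic

-- The ceiling is computed as the negative of the floor of `-n / k`, so the claim reduces to that
-- floor being at most `-s`.
≤-ceiling : ∀ s n k .{{_ : NonZero k}} → s * k ≤ n → + s ≤ᶻ ceiling (+ n / k)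
≤-ceiling s n k@(suc _) sk≤n = begin
  + s                ≡⟨ ℤ.neg-involutive (+ s) ⟨
  ℤ.- (ℤ.- + s)      ≤⟨ ℤ.neg-mono-≤ (ℤ.*-cancelʳ-≤-pos f (ℤ.- + s) (+ k) (begin
    f ℤ.* + k          ≤⟨ ℤ.[n/d]*d≤n (ℤ.- + n) (+ k) ⟩
    ℤ.- + n            ≤⟨ ℤ.neg-mono-≤ (ℤ.+≤+ sk≤n) ⟩
    ℤ.- + (s * k)      ≡⟨ cong ℤ.-_ (ℤ.pos-* s k) ⟩
    ℤ.- (+ s ℤ.* + k)  ≡⟨ ℤ.neg-distribˡ-* (+ s) (+ k) ⟩
    (ℤ.- + s) ℤ.* + k  ∎)) ⟩
  ℤ.- f              ∎
  where
  open ℤ.≤-Reasoning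
  f = (ℤ.- + n) ℤ./ + k

log-floor : ∀ k → 1 < k → ∃[ L ] 1 ≤ L × 2 ^ L ≤ k × k < 2 ^ suc L
log-floor (suc k) 1<k with 1 <? k
... | no 1≮k = 1 , s≤s z≤n , 1<k , s≤s (s≤s (≤-trans (≤-pred (≰⇒> (1≮k ∘ ≤-trans ≤-refl))) (m≤n+m 1 1)))
... | yes 1<k′ with log-floor k 1<k′
...   | L , 1≤L , lo , hi with suc k <? 2 ^ suc L
...     | yes lt = L , 1≤L , m≤n⇒m≤1+n lo , lt
...     | no ¬lt = suc L , s≤s z≤n , ≮⇒≥ ¬lt , (begin-strict
  suc k                  ≤⟨ hi ⟩
  2 ^ suc L              <⟨ ^-monoʳ-< 2 (s≤s (s≤s z≤n)) (n<1+n (suc L)) ⟩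
  2 ^ suc (suc L)        ∎)
  where open ≤-Reasoning

-- The cut is strict, so it is probed just below, at the rational a k L - 1.
cut-bound : ∀ a k L m .{{_ : NonZero a}} .{{_ : NonZero k}} → 1 ≤ L → 2 ^ L ≤ k →
            a ∙ k ∙ log₂ k ≤ᶜ fromNat m → a * (k * L) ≤ m
cut-bound a@(suc a′) k@(suc k′) L@(suc L′) m _ 2^L≤k cut = below (a * (k * L)) refl
  where
  below : ∀ P → a * (k * L) ≡ P → P ≤ m
  below zero    _  = z≤n
  below (suc p) eq = ℤ.drop‿+<+ (subst₂ ℤ._<_ (ℤ.*-identityʳ (+ p)) (ℤ.*-identityʳ (+ m))
      (ℚᵘ.drop-*<* (cut {mkℚᵘ (+ p) 0}
      (subst (λ z → log₂ k (mkℚᵘ z (k′ + a″ * k)))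
        (sym (trans (ℤ.*-identityʳ (+ p ℤ.* + 1)) (ℤ.*-identityʳ (+ p))))
        (subst (λ d → 2 ^ p < k ^ d) den 2^p<)))))
    where
    open ≤-Reasoning
    -- Unnormalised fractions are not reduced: `p / 1` times `1 / a` has denominator `1 * a`, whose
    -- predecessor is `a′ + 0`. The inequality `2^p<` puts `p / (a k)` below `log₂ k`.
    a″ = a′ + 0
    den : a * k ≡ suc (k′ + a″ * k)
    den = cong (λ b → suc (k′ + b * k)) (sym (+-identityʳ a′))
    2^p< : 2 ^ p < k ^ (a * k)
    2^p< = begin-strict
      2 ^ p             <⟨ ^-monoʳ-< 2 (s≤s (s≤s z≤n)) (n<1+n p) ⟩
      2 ^ suc p         ≡⟨ cong (2 ^_) eq ⟨
      2 ^ (a * (k * L)) ≡⟨ cong (2 ^_) (rot a k L) ⟩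
      2 ^ (L * (a * k)) ≡⟨ ^-*-assoc 2 L (a * k) ⟨
      (2 ^ L) ^ (a * k) ≤⟨ ^-monoˡ-≤ (a * k) 2^L≤k ⟩
      k ^ (a * k)       ∎
      where
      rot : ∀ a k L → a * (k * L) ≡ L * (a * k)
      rot = solve-∀

m<[1+m/n]*n : ∀ m n .{{_ : NonZero n}} → m < suc (m ℕ./ n) * n
m<[1+m/n]*n m n = begin-strict
  m                   ≡⟨ m≡m%n+[m/n]*n m n ⟩
  m % n + m ℕ./ n * n   <⟨ +-monoˡ-< (m ℕ./ n * n) (m%n<n m n) ⟩
  n + m ℕ./ n * n       ∎
  where open ≤-Reasoning

-- This is `(1 + 1/A) ^ j ≥ 1 + j/A` with denominators cleared.
bernoulli : ∀ A j → A ^ j * (A + j) ≤ suc A ^ j * A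
bernoulli A zero    = ≤-reflexive (cong (1 *_) (+-identityʳ A))
bernoulli A (suc j) = begin
  A * A ^ j * (A + suc j)                 ≤⟨ m≤m+n _ (A ^ j * j) ⟩
  A * A ^ j * (A + suc j) + A ^ j * j     ≡⟨ regroup A (A ^ j) j ⟩
  suc A * (A ^ j * (A + j))               ≤⟨ *-monoʳ-≤ (suc A) (bernoulli A j) ⟩
  suc A * (suc A ^ j * A)                 ≡⟨ *-assoc (suc A) (suc A ^ j) A ⟨
  suc A * suc A ^ j * A                   ∎
  where
  open ≤-Reasoning
  regroup : ∀ a p j → a * p * (a + suc j) + p * j ≡ suc a * (p * (a + j))
  regroup = solve-∀

-- Bernoulli's inequality at `j = A`: growth by `1 + 1/A` doubles in `A` steps.
double≤suc^ : ∀ A .{{_ : NonZero A}} → 2 * A ^ A ≤ suc A ^ A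
double≤suc^ A = *-cancelʳ-≤ _ _ A (begin
  2 * A ^ A * A     ≡⟨ regroup A (A ^ A) ⟩
  A ^ A * (A + A)   ≤⟨ bernoulli A A ⟩
  suc A ^ A * A     ∎)
  where
  open ≤-Reasoning
  regroup : ∀ a p → 2 * p * a ≡ p * (a + a)
  regroup = solve-∀

2^r≤suc^ : ∀ A .{{_ : NonZero A}} r → 2 ^ r * A ^ (A * r) ≤ suc A ^ (A * r)
2^r≤suc^ A r = subst₂ (λ x y → 2 ^ r * x ≤ y) (^-*-assoc A A r) (^-*-assoc (suc A) A r) (powers r)
  where
  open ≤-Reasoning
  regroup : ∀ x y z → 2 * x * (y * z) ≡ 2 * y * (x * z)
  regroup = solve-∀
  powers : ∀ r → 2 ^ r * (A ^ A) ^ r ≤ (suc A ^ A) ^ r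
  powers zero    = ≤-refl
  powers (suc r) = begin
    2 * 2 ^ r * (A ^ A * (A ^ A) ^ r)   ≡⟨ regroup (2 ^ r) (A ^ A) ((A ^ A) ^ r) ⟩
    2 * A ^ A * (2 ^ r * (A ^ A) ^ r)   ≤⟨ *-mono-≤ (double≤suc^ A) (powers r) ⟩
    suc A ^ A * (suc A ^ A) ^ r         ∎

-- In `A * r` steps the growth factor is at least `2 ^ r`, while `A + n < A * (1 + t) ≤ A * 2 ^ r`.
ball-exhausts : ∀ A .{{_ : NonZero A}} r t n → n < A * t → t < 2 ^ r →
                A ^ (A * r) * (A + n) < suc A ^ (A * r) * A
ball-exhausts A r t n n<At t<2^r = begin-strict
  A ^ R * (A + n)          <⟨ *-monoʳ-< (A ^ R) {{m^n≢0 A R}} (+-monoʳ-< A n<At) ⟩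
  A ^ R * (A + A * t)      ≡⟨ cong (A ^ R *_) (*-suc A t) ⟨
  A ^ R * (A * suc t)      ≤⟨ *-monoʳ-≤ (A ^ R) (*-monoʳ-≤ A t<2^r) ⟩
  A ^ R * (A * 2 ^ r)      ≡⟨ regroup (A ^ R) A (2 ^ r) ⟩
  2 ^ r * A ^ R * A        ≤⟨ *-monoˡ-≤ A (2^r≤suc^ A r) ⟩
  suc A ^ R * A            ∎
  where
  open ≤-Reasoning
  R = A * r
  regroup : ∀ x y z → x * (y * z) ≡ z * x * y
  regroup = solve-∀

2*L≤2^L : ∀ {L} → 1 ≤ L → 2 * L ≤ 2 ^ L
2*L≤2^L {suc zero}      _ = ≤-refl
2*L≤2^L {suc L@(suc _)} _ = begin
  2 * suc L         ≡⟨ *-suc 2 L ⟩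
  2 + 2 * L         ≤⟨ +-mono-≤ (*-monoʳ-≤ 2 {1} {L} (s≤s z≤n)) ≤-refl ⟩
  2 * L + 2 * L     ≡⟨ cong (_+_ (2 * L)) (+-identityʳ (2 * L)) ⟨
  2 * (2 * L)       ≤⟨ *-monoʳ-≤ 2 (2*L≤2^L (s≤s z≤n)) ⟩
  2 * 2 ^ L         ∎
  where open ≤-Reasoning

-- Choice of parameters in the two cases

module Parameters (k L n : ℕ) .{{_ : NonZero k}} (1≤L : 1 ≤ L) (k<2^ : k < 2 ^ suc L)
                  (n-large : 301 * (k * L) ≤ n) where
  open ≤-Reasoning

  private instance
    L≢0 : NonZero L
    L≢0 = >-nonZero 1≤L

  κ Q : ℕ
  κ = k * L
  Q = n ℕ./ k

  κ>0 : 0 < κ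
  κ>0 = >-nonZero⁻¹ κ {{m*n≢0 k L}}

  n<[1+Q]*k : n < suc Q * k
  n<[1+Q]*k = m<[1+m/n]*n n k

  Q-large : 301 * L ≤ Q
  Q-large = begin
    301 * L               ≡⟨ m*n/n≡m (301 * L) k ⟨
    301 * L * k ℕ./ k       ≡⟨ cong (ℕ._/ k) (regroup k L 301) ⟩
    301 * (k * L) ℕ./ k     ≤⟨ /-monoˡ-≤ k n-large ⟩
    Q                     ∎
    where
    regroup : ∀ k L c → c * L * k ≡ c * (k * L)
    regroup = solve-∀

  -- One more than the quotient of `Q` by `c * L` serves as an integer above `n / (c * κ)`. It is
  -- used with `c = 16` for the growth of balls and with `c = 45` for domination.
  quotient-bound : ∀ c .{{_ : NonZero (c * L)}} → n < suc (Q ℕ./ (c * L)) * (c * κ)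
  quotient-bound c = begin-strict
    n                                <⟨ n<[1+Q]*k ⟩
    suc Q * k                        ≤⟨ *-monoˡ-≤ k (m<[1+m/n]*n Q (c * L)) ⟩
    suc (Q ℕ./ (c * L)) * (c * L) * k  ≡⟨ regroup (suc (Q ℕ./ (c * L))) c L k ⟩
    suc (Q ℕ./ (c * L)) * (c * κ)      ∎
    where
    regroup : ∀ q c L k → q * (c * L) * k ≡ q * (c * (k * L))
    regroup = solve-∀

  instance
    16L≢0 : NonZero (16 * L)
    16L≢0 = m*n≢0 16 L
    45L≢0 : NonZero (45 * L)
    45L≢0 = m*n≢0 45 L

  -- `A₁₆` exceeds `n / 16κ`. The exponent `r` makes `2 ^ r` exceed `16 * κ`, as
  -- `k * L < 2 ^ L * (2 * L) ≤ 2 ^ (2 * L)`.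
  q₁₆ A₁₆ r R : ℕ
  q₁₆ = Q ℕ./ (16 * L)
  A₁₆ = suc q₁₆
  r = 4 + 2 * L
  R = A₁₆ * r

  16κ<2^r : 16 * κ < 2 ^ r
  16κ<2^r = begin-strict
    16 * (k * L)              <⟨ *-monoʳ-< 16 (*-monoˡ-< L k<2^) ⟩
    16 * (2 * 2 ^ L * L)      ≡⟨ regroup 16 (2 ^ L) L ⟩
    16 * (2 ^ L * (2 * L))    ≤⟨ *-monoʳ-≤ 16 (*-monoʳ-≤ (2 ^ L) (2*L≤2^L 1≤L)) ⟩
    16 * (2 ^ L * 2 ^ L)      ≡⟨ cong (16 *_) (^-distribˡ-+-* 2 L L) ⟨
    2 ^ 4 * 2 ^ (L + L)       ≡⟨ ^-distribˡ-+-* 2 4 (L + L) ⟨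
    2 ^ (4 + (L + L))         ≡⟨ cong (λ x → 2 ^ (4 + (L + x))) (+-identityʳ L) ⟨
    2 ^ r                     ∎
    where
    regroup : ∀ c p L → c * (2 * p * L) ≡ c * (p * (2 * L))
    regroup = solve-∀

  -- As `r ≤ 6 * L`, the left side is at most `14 * L + 12 * q₁₆ * L`. The first term is at most
  -- `Q / 4` because `56 ≤ 301`, the second at most `3 * Q / 4` because `16 * q₁₆ * L ≤ Q`.
  girth-bound : 2 + (R + R) ≤ Q
  girth-bound = *-cancelˡ-≤ 4 (begin
    4 * (2 + (A₁₆ * r + A₁₆ * r))
      ≤⟨ *-monoʳ-≤ 4 (+-mono-≤ (*-monoʳ-≤ 2 1≤L) (+-mono-≤ Ar Ar)) ⟩
    4 * (2 * L + (A₁₆ * (6 * L) + A₁₆ * (6 * L)))    ≡⟨ regroup q₁₆ L ⟩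
    56 * L + 3 * (q₁₆ * (16 * L))
      ≤⟨ +-mono-≤ (≤-trans (*-monoˡ-≤ L {56} {301} (≤ᵇ⇒≤ 56 301 _)) Q-large)
                                                             (*-monoʳ-≤ 3 (m/n*n≤m Q (16 * L))) ⟩
    Q + 3 * Q                                    ∎)
    where
    Ar : A₁₆ * r ≤ A₁₆ * (6 * L)
    Ar = *-monoʳ-≤ A₁₆ (begin
      4 + 2 * L        ≤⟨ +-monoˡ-≤ (2 * L) (*-monoʳ-≤ 4 1≤L) ⟩
      4 * L + 2 * L    ≡⟨ *-distribʳ-+ L 4 2 ⟨
      6 * L            ∎)
    regroup : ∀ q L → 4 * (2 * L + (suc q * (6 * L) + suc q * (6 * L))) ≡ 56 * L + 3 * (q * (16 * L))
    regroup = solve-∀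

  -- `a` exceeds `n / 45κ`, and `h`, about half of `Q`, is what may be left to single picks. From
  -- `n < suc Q * k`, `suc Q ≤ 2 * h` and `k < 2 ^ suc L` it follows that `2 + L` halvings reach
  -- `h`.
  q₄₅ a h j : ℕ
  q₄₅ = Q ℕ./ (45 * L)
  a = suc q₄₅
  h = suc (Q ℕ./ 2)
  j = 2 + L

  n≤2^jh : n ≤ 2 ^ j * h
  n≤2^jh = begin
    n                          ≤⟨ <⇒≤ n<[1+Q]*k ⟩
    suc Q * k                  ≤⟨ *-mono-≤ (m<[1+m/n]*n Q 2) (<⇒≤ k<2^) ⟩
    suc (Q ℕ./ 2) * 2 * 2 ^ suc L ≡⟨ regroup (suc (Q ℕ./ 2)) (2 ^ suc L) ⟩
    2 * 2 ^ suc L * h          ∎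
    where
    regroup : ∀ h p → h * 2 * p ≡ 2 * p * h
    regroup = solve-∀

  -- With `j ≤ 3 * L` the left side is at most `4 * L + 3 * q₄₅ * L + Q / 2`. The terms are at most
  -- `Q / 30`, `Q / 15` and `Q / 2`, in all 18 thirtieths of `Q`.
  dominating-bound : j * a + h ≤ Q
  dominating-bound = *-cancelˡ-≤ 30 (begin
    30 * (j * a + h)
      ≤⟨ *-monoʳ-≤ 30 (+-mono-≤ (*-monoˡ-≤ a j≤3L) (+-monoˡ-≤ (Q ℕ./ 2) 1≤L)) ⟩
    30 * (3 * L * a + (L + Q ℕ./ 2))         ≡⟨ regroup q₄₅ (Q ℕ./ 2) L ⟩
    120 * L + (2 * (q₄₅ * (45 * L)) + 15 * (Q ℕ./ 2 * 2))
      ≤⟨ +-mono-≤ (≤-trans (*-monoˡ-≤ L {120} {301} (≤ᵇ⇒≤ 120 301 _)) Q-large)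
                                                (+-mono-≤ (*-monoʳ-≤ 2 (m/n*n≤m Q (45 * L))) (*-monoʳ-≤ 15 (m/n*n≤m Q 2))) ⟩
    Q + (2 * Q + 15 * Q)                   ≡⟨ collect Q ⟩
    18 * Q                                 ≤⟨ *-monoˡ-≤ Q {18} {30} (≤ᵇ⇒≤ 18 30 _) ⟩
    30 * Q                                 ∎)
    where
    j≤3L : j ≤ 3 * L
    j≤3L = begin
      2 + L         ≤⟨ +-monoˡ-≤ L (*-monoʳ-≤ 2 1≤L) ⟩
      2 * L + L     ≡⟨ three L ⟩
      3 * L         ∎
      where
      three : ∀ L → 2 * L + L ≡ 3 * L
      three = solve-∀
    collect : ∀ q → q + (2 * q + 15 * q) ≡ 18 * q
    collect = solve-∀
    regroup : ∀ q s L → 30 * (3 * L * suc q + (L + s)) ≡ 120 * L + (2 * (q * (45 * L)) + 15 * (s * 2))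
    regroup = solve-∀

-- Stars and the other colours

module ColouredGraph {n : ℕ} (G : Graph n) (simple : Graph.Simple G) (c : Graph.Edge G → Fin n)
                     (m : ℕ) (large : ∀ i → m ≤ classSize c i) where
  open Graph G
  open Paths G using (Joins-sym)
  open SparseGirth G using (src; tgt)
  open import Data.List.Membership.DecPropositional (_≟_ {n}) using (_∈?_; _∉?_)

  class : Fin n → List Edge
  class i = filter (λ e → c e ≟ i) (allFin size)

  ∈-class⁻ : ∀ {e i} → e ∈ class i → c e ≡ i
  ∈-class⁻ {i = i} e∈ = proj₂ (∈-filter⁻ (λ e → c e ≟ i) {xs = allFin size} e∈)

  class-unique : ∀ i → Unique (class i)
  class-unique i = Uniq.filter⁺ (λ e → c e ≟ i) (Uniq.allFin⁺ size)

  ends-injective : ∀ {e f} → ends e ≡ ends f → e ≡ f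
  ends-injective {e} {f} eq = proj₂ simple e f (src f) (tgt f) (inj₁ eq) (inj₁ refl)

  classes-disjoint-union : ∀ {is} → Unique is →
    ∃[ es ] Unique es × (∀ {e} → e ∈ es → c e ∈ is) × length is * m ≤ length es
  classes-disjoint-union [] = [] , [] , (λ ()) , z≤n
  classes-disjoint-union {i ∷ is} (i∉ ∷ u) with classes-disjoint-union u
  ... | es , ues , es⊆ , le = class i ++ es
      , Uniq.++⁺ (class-unique i) ues
          (λ (e∈ , e∈es) → All¬⇒¬Any i∉ (subst (_∈ is) (∈-class⁻ e∈) (es⊆ e∈es)))
      , (λ e∈ → [ here ∘ ∈-class⁻ , there ∘ es⊆ ]′ (∈-++⁻ (class i) e∈))
      , ≤-trans (+-mono-≤ (large i) le) (≤-reflexive (sym (length-++ (class i))))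

  -- The `n` colour classes are disjoint, and in a simple graph the ordered pair `ends e` determines
  -- `e`, so `n * m ≤ n * n`. This makes `n` large in terms of `κ`.
  m≤n : .{{NonZero n}} → m ≤ n
  m≤n with classes-disjoint-union (Uniq.allFin⁺ n)
  ... | es , ues , _ , le = *-cancelˡ-≤ n (begin
    n * m                                     ≡⟨ cong (_* m) (length-allFin n) ⟨
    length (allFin n) * m                     ≤⟨ le ⟩
    length es                                 ≡⟨ length-map ends es ⟨
    length (map ends es)                      ≤⟨ unique-⊆⇒length-≤ (Uniq.map⁺ ends-injective ues)
                                                   (λ _ → ∈-cartesianProduct⁺ (∈-allFin _) (∈-allFin _)) ⟩
    length (cartesianProduct (allFin n) (allFin n)) ≡⟨ length-cartesianProduct (allFin n) (allFin n) ⟩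
    length (allFin n) * length (allFin n)     ≡⟨ cong₂ _*_ (length-allFin n) (length-allFin n) ⟩
    n * n                                     ∎)
    where open ≤-Reasoning

  Touches : Fin n → Edge → Set
  Touches v e = src e ≡ v ⊎ tgt e ≡ v

  touches? : ∀ v → Decidable (Touches v)
  touches? v e = (src e ≟ v) ⊎-dec (tgt e ≟ v)

  StarAt : Fin n → Fin n → Set
  StarAt i v = All (Touches v) (class i)

  Star : Fin n → Set
  Star i = ∃ (StarAt i)

  starAt? : ∀ i → Decidable (StarAt i)
  starAt? i v = All.all? (touches? v) (class i)

  star? : Decidable Star
  star? i = any? (starAt? i)

  -- On a colour that is not a star, `centre` is a junk value.
  centre : Fin n → Fin n
  centre i with star? i
  ... | yes (v , _) = v
  ... | no _        = i

  centre-star : ∀ {i} → Star i → StarAt i (centre i)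
  centre-star {i} st with star? i
  ... | yes (_ , at) = at
  ... | no ¬st       = contradiction st ¬st

  other : Fin n → Edge → Fin n
  other v e with src e ≟ v
  ... | yes _ = tgt e
  ... | no  _ = src e

  other-joins : ∀ {v e} → Touches v e → Joins e v (other v e)
  other-joins {v} {e} t with src e ≟ v | t
  ... | yes refl | _         = inj₁ refl
  ... | no s≢v   | inj₁ s≡v  = contradiction s≡v s≢v
  ... | no _     | inj₂ refl = inj₂ refl

  -- Two edges from `v` to the same leaf would be parallel.
  leaves : ∀ {i v} → StarAt i v →
           Unique (map (other v) (class i)) × m ≤ length (map (other v) (class i))
  leaves {i} {v} st = unique , subst (m ≤_) (sym (length-map (other v) (class i))) (large i)
    where
    unique : Unique (map (other v) (class i))
    unique with unique-map⊎collision _≟_ (other v) (class-unique i)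
    ... | inj₁ u = u
    ... | inj₂ (e , f , e∈ , f∈ , e≢f , eq) = contradiction
            (proj₂ simple e f v (other v f)
              (subst (Joins e v) eq (other-joins (All.lookup st e∈))) (other-joins (All.lookup st f∈))) e≢f

  Survives : List (Fin n) → Fin n → Set
  Survives X i = ∃[ e ] c e ≡ i × src e ∉ X × tgt e ∉ X

  joins-survives : ∀ {X i e x y} → c e ≡ i → Joins e x y → x ∉ X → y ∉ X → Survives X i
  joins-survives {X} {e = e} ce (inj₁ eq) x∉ y∉ =
    e , ce , subst (_∉ X) (sym (cong proj₁ eq)) x∉ , subst (_∉ X) (sym (cong proj₂ eq)) y∉
  joins-survives {X} {e = e} ce (inj₂ eq) x∉ y∉ =
    e , ce , subst (_∉ X) (sym (cong proj₁ eq)) y∉ , subst (_∉ X) (sym (cong proj₂ eq)) x∉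

  -- `X` misses the centre and is too small to contain all the leaves, of which there are at least
  -- `m`.
  star-survives : ∀ {X i v} → StarAt i v → v ∉ X → length X < m → Survives X i
  star-survives {X} {i} {v} st v∉ X<m with Any.any? (_∉? X) (map (other v) (class i))
  ... | yes some with find some
  ...   | w , w∈ , w∉ with ∈-map⁻ (other v) w∈
  ...     | e , e∈ , refl = joins-survives (∈-class⁻ e∈) (other-joins (All.lookup st e∈)) v∉ w∉
  star-survives {X} {i} {v} st v∉ X<m | no none =
      contradiction X<m (≤⇒≯ (≤-trans m≤ (unique-⊆⇒length-≤ unique inside)))
    where
    unique = proj₁ (leaves st)
    m≤ = proj₂ (leaves st)
    inside : ∀ {w} → w ∈ map (other v) (class i) → w ∈ X
    inside {w} w∈ with w ∈? X
    ... | yes w∈X = w∈X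
    ... | no w∉X  = contradiction (lose w∈ w∉X) none

  -- A set meeting e₀ = ab, an edge e₁ that misses a and an edge e₂ that misses b
  -- contains a and an end of e₁, or b and an end of e₂.
  blockers : ∀ {i e₀} → e₀ ∈ class i → ¬ Star i →
    ∃[ ps ] length ps ≤ 4 × (∀ {X} → Independent _≟_ ps X → Survives X i)
  blockers {i} {e₀} e₀∈ ¬st
    with find (¬All⇒Any¬ (touches? (src e₀)) (class i) (λ st → ¬st (_ , st)))
       | find (¬All⇒Any¬ (touches? (tgt e₀)) (class i) (λ st → ¬st (_ , st)))
  ... | e₁ , e₁∈ , misses₁ | e₂ , e₂∈ , misses₂ =
      (src e₀ , src e₁) ∷ (src e₀ , tgt e₁) ∷ (tgt e₀ , src e₂) ∷ (tgt e₀ , tgt e₂) ∷ []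
    , ≤-refl , survives
    where
    survives : ∀ {X} → Independent _≟_ _ X → Survives X i
    survives {X} ind with src e₀ ∈? X | tgt e₀ ∈? X
    ... | yes s∈ | _ = e₁ , ∈-class⁻ e₁∈
        , (λ e∈ → misses₁ (inj₁ (sym (ind (here refl) s∈ e∈))))
        , (λ e∈ → misses₁ (inj₂ (sym (ind (there (here refl)) s∈ e∈))))
    ... | no _ | yes t∈ = e₂ , ∈-class⁻ e₂∈
        , (λ e∈ → misses₂ (inj₁ (sym (ind (there (there (here refl))) t∈ e∈))))
        , (λ e∈ → misses₂ (inj₂ (sym (ind (there (there (there (here refl)))) t∈ e∈))))
    ... | no s∉ | no t∉ = e₀ , ∈-class⁻ e₀∈ , s∉ , t∉

  stars nonstars centres W Z : List (Fin n)
  stars    = filter star? (allFin n)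
  nonstars = filter (∁? star?) (allFin n)
  centres  = map centre stars
  W        = filter (_∈? centres) (allFin n)
  Z        = filter (_∉? centres) (allFin n)

  W+Z≡n : length W + length Z ≡ n
  W+Z≡n = trans (length-filter-∁ (_∈? centres) (allFin n)) (length-allFin n)

  -- There are as many colours as vertices, and at most as many centres as stars; the complements
  -- compare the other way round.
  nonstars≤Z : length nonstars ≤ length Z
  nonstars≤Z = +-cancelˡ-≤ (length stars) _ _ (begin
    length stars + length nonstars  ≡⟨ length-filter-∁ star? (allFin n) ⟩
    length (allFin n)               ≡⟨ length-allFin n ⟩
    n                               ≡⟨ W+Z≡n ⟨
    length W + length Z             ≤⟨ +-monoˡ-≤ (length Z) W≤stars ⟩
    length stars + length Z         ∎)
    where
    open ≤-Reasoning
    W≤stars : length W ≤ length stars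
    W≤stars = subst (length W ≤_) (length-map centre stars)
      (unique-⊆⇒length-≤ (Uniq.filter⁺ (_∈? centres) (Uniq.allFin⁺ n))
        (λ w∈ → proj₂ (∈-filter⁻ (_∈? centres) {xs = allFin n} w∈)))

  -- The case of many vertices that are not centres

  module _ (m>0 : 0 < m) where

    class-inhabited : ∀ i → ∃[ e ] e ∈ class i
    class-inhabited i with class i | large i
    ... | []    | m≤0 = contradiction (≤-trans m>0 m≤0) (λ ())
    ... | e ∷ _ | _   = e , here refl

    all-blockers : ∀ is → (∀ {i} → i ∈ is → ¬ Star i) →
      ∃[ ps ] length ps ≤ length is * 4 × (∀ {X i} → i ∈ is → Independent _≟_ ps X → Survives X i)
    all-blockers [] _ = [] , z≤n , λ ()
    all-blockers (i ∷ is) ¬st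
      with blockers (proj₂ (class-inhabited i)) (¬st (here refl)) | all-blockers is (¬st ∘ there)
    ... | ps , ps≤ , surv | qs , qs≤ , survs =
        ps ++ qs , ≤-trans (≤-reflexive (length-++ ps)) (+-mono-≤ ps≤ qs≤)
      , λ { (here refl) ind → surv (ind ∘ ∈-++⁺ˡ)
          ; (there i∈)  ind → survs i∈ (ind ∘ ∈-++⁺ʳ ps) }

    -- At most `4 * |Z|` pairs block the colours that are not stars, so
    -- `8 * |Z| ≤ 64 * |xs| + 4 * |Z|` and `|xs| ≥ |Z| / 16 ≥ t`. Independence passes to the first
    -- `t` elements of `xs`.
    harmless-set : ∀ t → 16 * t ≤ length Z → t < m →
      ∃[ X ] Unique X × length X ≡ t × (∀ i → Survives X i)
    harmless-set t 16t≤Z t<m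
      with all-blockers nonstars (λ i∈ → proj₂ (∈-filter⁻ (∁? star?) {xs = allFin n} i∈))
    ... | ps , ps≤ , survs
      with independentSet _≟_ Z ps (Uniq.filter⁺ (_∉? centres) (Uniq.allFin⁺ n))
    ... | xs , uxs , xs⊆ , ind , bound = X , Uniq.take⁺ t uxs , X≡t , survives
      where
      open ≤-Reasoning
      X = take t xs
      t≤xs : t ≤ length xs
      t≤xs = *-cancelˡ-≤ 64 (+-cancelʳ-≤ (4 * length Z) _ _ (begin
        64 * t + 4 * length Z              ≡⟨ cong (_+ 4 * length Z) (*-assoc 4 16 t) ⟩
        4 * (16 * t) + 4 * length Z        ≤⟨ +-monoˡ-≤ _ (*-monoʳ-≤ 4 16t≤Z) ⟩
        4 * length Z + 4 * length Z        ≡⟨ *-distribʳ-+ (length Z) 4 4 ⟨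
        8 * length Z                       ≤⟨ bound ⟩
        64 * length xs + length ps         ≤⟨ +-monoʳ-≤ (64 * length xs) (begin
          length ps                          ≤⟨ ps≤ ⟩
          length nonstars * 4                ≤⟨ *-monoˡ-≤ 4 nonstars≤Z ⟩
          length Z * 4                       ≡⟨ *-comm (length Z) 4 ⟩
          4 * length Z                       ∎) ⟩
        64 * length xs + 4 * length Z      ∎))
      X≡t : length X ≡ t
      X≡t = trans (length-take t xs) (m≤n⇒m⊓n≡m t≤xs)
      survives : ∀ i → Survives X i
      survives i with star? i
      ... | no ¬st = survs (∈-filter⁺ (∁? star?) (∈-allFin i) ¬st)
                       (λ ab∈ a∈ b∈ → ind ab∈ (take-⊆ t xs a∈) (take-⊆ t xs b∈))
      ... | yes st = star-survives (centre-star st) (λ v∈ → proj₂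
              (∈-filter⁻ (_∉? centres) {xs = allFin n} (xs⊆ (take-⊆ t xs v∈)))
              (∈-map⁺ centre (∈-filter⁺ star? (∈-allFin i) st)))
              (subst (_< m) (sym X≡t) t<m)

    many-noncentres : ∀ A .{{_ : NonZero A}} r t → 16 * t ≤ length Z → t < m → n < A * t → t < 2 ^ r →
                      RainbowCycle G c (2 + (A * r + A * r))
    many-noncentres A r t 16t≤Z t<m n<At t<2^r = colour (harmless-set t 16t≤Z t<m)
      where
      colour : ∃[ X ] Unique X × length X ≡ t × (∀ i → Survives X i) → RainbowCycle G c (2 + (A * r + A * r))
      colour (X , uX , refl , survives) =
        recolour-cycle G c (λ i → proj₁ (survives i)) (λ i → proj₁ (proj₂ (survives i)))
          (SparseGirth.sparse-girth _ A (A * r) n (ball-exhausts A r t n n<At t<2^r)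
            X uX (λ i → proj₂ (proj₂ (survives i))) ≤-refl ≤-refl n<At)

    -- The case of few vertices that are not centres

    OutEdge : Fin n → Fin n → Edge → Set
    OutEdge u w e = centre (c e) ≡ u × Joins e u w

    -- The colour of an edge determines, through `centre`, the vertex it leaves. Edges that leave
    -- different vertices thus have different colours, junk values of `centre` included.
    _⟶_ : Fin n → Fin n → Set
    u ⟶ w = ∃ (OutEdge u w)

    _⟶?_ : ∀ u w → Dec (u ⟶ w)
    u ⟶? w = any? λ e → (centre (c e) ≟ u) ×-dec
      ((≡-dec _≟_ _≟_ (ends e) (u , w)) ⊎-dec (≡-dec _≟_ _≟_ (ends e) (w , u)))

    -- Of the at least `m` leaves of the star at `u`, at most `|Z|` lie in `Z`; the others are
    -- centres.
    rich : ∀ d {u} → u ∈ W → d + length Z ≤ m → d ≤ length (filter (u ⟶?_) W)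
    rich d {u} u∈ d+Z≤m with ∈-map⁻ centre (proj₂ (∈-filter⁻ (_∈? centres) {xs = allFin n} u∈))
    ... | i , i∈ , refl = +-cancelʳ-≤ (length Z) _ _ (begin
      d + length Z                                   ≤⟨ d+Z≤m ⟩
      m                                              ≤⟨ proj₂ (leaves st) ⟩
      length (map (other u) (class i))               ≤⟨ unique-⊆⇒length-≤ (proj₁ (leaves st)) inside ⟩
      length (filter (u ⟶?_) W ++ Z)                 ≡⟨ length-++ (filter (u ⟶?_) W) ⟩
      length (filter (u ⟶?_) W) + length Z           ∎)
      where
      open ≤-Reasoning
      st : StarAt i (centre i)
      st = centre-star (proj₂ (∈-filter⁻ star? {xs = allFin n} i∈))
      inside : ∀ {w} → w ∈ map (other u) (class i) → w ∈ filter (u ⟶?_) W ++ Z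
      inside {w} w∈ with w ∈? centres | ∈-map⁻ (other u) w∈
      ... | no w∉ | _ = ∈-++⁺ʳ (filter (u ⟶?_) W) (∈-filter⁺ (_∉? centres) (∈-allFin w) w∉)
      ... | yes w∈c | e , e∈ , refl = ∈-++⁺ˡ (∈-filter⁺ (u ⟶?_) (∈-filter⁺ (_∈? centres) (∈-allFin w) w∈c)
              (e , cong centre (∈-class⁻ e∈) , other-joins (All.lookup st e∈)))

    few-noncentres : ∀ {w} → w ∈ W → ∀ d a j h → 1 ≤ d → d + length Z ≤ m → n ≤ a * d → n ≤ 2 ^ j * h →
                     RainbowCycle G c (j * a + h)
    few-noncentres {w} w∈ d a j h 1≤d d+Z≤m n≤ad n≤2^jh = walk
      (Domination.dominating-set _⟶?_ W d w∈ a (≤-trans W≤n n≤ad) 1≤d j h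
        (λ u∈ → rich d u∈ d+Z≤m) (≤-trans W≤n n≤2^jh))
      where
      W≤n : length W ≤ n
      W≤n = m+n≤o⇒m≤o (length W) (≤-reflexive W+Z≡n)
      walk : ∃[ Y ] (∀ {y} → y ∈ Y → y ∈ W) × length Y ≤ j * a + h ×
                    (∀ {u} → u ∈ W → ∃[ y ] y ∈ Y × u ⟶ y) → RainbowCycle G c (j * a + h)
      walk (Y , Y⊆ , Y≤ , dominated) = widen G c Y≤
        (functional-cycle G c Y (proj₁ ∘ next) (proj₂ ∘ next) (proj₁ ∘ next-spec)
          (proj₂ ∘ proj₂ ∘ next-spec) own (proj₁ (proj₂ (dominated w∈))))
        where
        next : Fin n → Fin n × Edge
        next v with Any.any? (v ⟶?_) Y
        ... | yes hit = proj₁ (find hit) , proj₁ (proj₂ (proj₂ (find hit)))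
        -- A default that is never taken for `v` in `Y`: such a `v` is a centre and has a dominator
        -- in `Y`.
        ... | no _    = v , proj₁ (class-inhabited v)
        next-spec : ∀ {v} → v ∈ Y → proj₁ (next v) ∈ Y × OutEdge v (proj₁ (next v)) (proj₂ (next v))
        next-spec {v} v∈ with Any.any? (v ⟶?_) Y
        ... | yes hit = proj₁ (proj₂ (find hit)) , proj₂ (proj₂ (proj₂ (find hit)))
        ... | no ¬hit with dominated (Y⊆ v∈)
        ...   | w , w∈ , v⟶w = contradiction (lose w∈ v⟶w) ¬hit
        own : ∀ {u v} → u ∈ Y → v ∈ Y → c (proj₂ (next u)) ≡ c (proj₂ (next v)) → u ≡ v
        own u∈ v∈ same = trans (sym (proj₁ (proj₂ (next-spec u∈))))
                           (trans (cong centre same) (proj₁ (proj₂ (next-spec v∈))))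

theorem2p1 : (k : ℕ) .{{_ : NonZero k}} → k > 1 →
    (n : ℕ) → n ≥ 1 →
    (G : Graph n) → Graph.Simple G →
    (c : Graph.Edge G → Fin n) →
    (∀ (i : Fin n) → 301 ∙ k ∙ log₂ k ≤ᶜ fromNat (classSize c i)) →
    Σ[ C ∈ Cycle G ] (Rainbow {G = G} c C × + Cycle.cycleLength C ≤ᶻ ceiling (+ n / k))
theorem2p1 k k>1 n n≥1 G simple c large with log-floor k k>1
... | L , 1≤L , 2^L≤k , k<2^ = conclude rainbow-cycle
  where
  -- From here on the hypothesis enters only through the integer bound `301 * κ` on the class sizes.
  open ColouredGraph G simple c (301 * (k * L)) (λ i → cut-bound 301 k L _ 1≤L 2^L≤k (λ {r} → large i {r}))
  instance
    n≢0 : NonZero n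
    n≢0 = >-nonZero n≥1
  open Parameters k L n 1≤L k<2^ m≤n
  open ≤-Reasoning

  scaled : ∀ a b → a ≤ b → a * κ ≤ b * κ
  scaled a b a≤b = *-monoˡ-≤ κ a≤b

  conclude : RainbowCycle G c Q →
             Σ[ C ∈ Cycle G ] (Rainbow {G = G} c C × + Cycle.cycleLength C ≤ᶻ ceiling (+ n / k))
  conclude (C , rainbow , len) = C , rainbow
    , ≤-ceiling (Cycle.cycleLength C) n k (≤-trans (*-monoˡ-≤ k len) (m/n*n≤m n k))

  m>0 : 0 < 301 * κ
  m>0 = ≤-trans κ>0 (≤-trans (≤-reflexive (sym (*-identityˡ κ))) (scaled 1 301 (≤ᵇ⇒≤ 1 301 _)))

  rainbow-cycle : RainbowCycle G c Q
  -- 256κ = 16 · 16κ for the size of the deleted set, and 301κ − 256κ = 45κ for the number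
  -- of neighbours of a centre outside Z.
  rainbow-cycle with 256 * κ ≤? length Z
  ... | yes many = widen G c girth-bound (many-noncentres m>0 A₁₆ r (16 * κ)
          (≤-trans (≤-reflexive (sym (*-assoc 16 16 κ))) many)
          (*-monoˡ-< κ {{>-nonZero κ>0}} {16} {301} (≤ᵇ⇒≤ 17 301 _)) (quotient-bound 16) 16κ<2^r)
  ... | no few with W in W≡
  -- Without centres `Z` would consist of all `n ≥ 301κ` vertices.
  ...   | []    = contradiction (begin-strict
            256 * κ             ≤⟨ scaled 256 301 (≤ᵇ⇒≤ 256 301 _) ⟩
            301 * κ             ≤⟨ m≤n ⟩
            n                   ≡⟨ W+Z≡n ⟨
            length W + length Z ≡⟨ cong (λ V → length V + length Z) W≡ ⟩
            length Z            <⟨ ≰⇒> few ⟩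
            256 * κ             ∎) (<-irrefl refl)
  ...   | w ∷ _ = widen G c dominating-bound (few-noncentres m>0 (subst (w ∈_) (sym W≡) (here refl))
            (45 * κ) a j h (≤-trans κ>0 (m≤n*m κ 45)) (begin
              45 * κ + length Z  ≤⟨ +-monoʳ-≤ (45 * κ) (<⇒≤ (≰⇒> few)) ⟩
              45 * κ + 256 * κ   ≡⟨ *-distribʳ-+ κ 45 256 ⟨
              301 * κ            ∎) (<⇒≤ (quotient-bound 45)) n≤2^jh)
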